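{- Let $R$ be a unique factorization domain with quotient field $Q(R)$, let $f(s)=\frac{a_m}{m^s}+\cdots+\frac{a_n}{n^s}$ be an algebraically primitive Dirichlet polynomial with coefficients in $R$, $a_ma_n\neq0$, and let $p_1,\dots,p_k$ be prime elements of $R$. For each $i=1,\dots,k$ let $q_{i,1},\dots,q_{i,n_i}$ be the relative degrees of all the segments of the Newton log-polygon of $f$ with respect to $p_i$ (listed with repetition), and define $$\mathcal S_{p_i}=S^1_{rd}(m,n)\cap\{q_{i,1}^{j_1}\cdots q_{i,n_i}^{j_{n_i}}: j_1,\dots,j_{n_i}\in\{0,1\}\}.$$ If $\mathcal S_{p_1}\cap\cdots\cap\mathcal S_{p_k}=\emptyset$, then $f$ is irreducible over $Q(R)$.
   Context: Dirichlet polynomials are multiplied by the Dirichlet product $\left(\sum_j\frac{b_j}{j^s}\right)\left(\sum_k\frac{c_k}{k^s}\right)=\sum_i\frac{\sum_{jk=i}b_jc_k}{i^s}$; constant means supported on $\{1\}$; algebraically primitive means indices with nonzero coefficient have gcd $1$; irreducible over $Q(R)$ means not a product of two nonconstant Dirichlet polynomials over $Q(R)$. Newton log-polygon of $f$ w.r.t. prime $p$: the lower convex hull of the points $(\log i,\nu_p(a_i))$, $a_i\ne0$ ($\nu_p$ the $p$-adic valuation), a polygonal line from $(\log m,\nu_p(a_m))$ to $(\log n,\nu_p(a_n))$ whose maximal straight pieces are its edges. A log-integral point is a point $(\log x,y)$ with $x$ a positive integer and $y$ an integer; the log-integral points on an edge divide it into segments (pieces containing no log-integral points other than their endpoints). The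 relative degree of a segment with endpoints $(\log i,\cdot)$, $(\log j,\cdot)$, $i<j$, is $j/i$. $S^1_{rd}(m,n)=\{\frac dc: d\mid n,\ c\mid m,\ 1<\frac dc\le\sqrt{n/m}\}$. -}

module Defs where

open import Level using (Level; _⊔_)
open import Algebra.Bundles using (CommutativeRing)
open import Data.Nat as Nat using (ℕ; zero; suc; _≤_; _<_)
open import Data.Nat.Divisibility as ND using (_∣?_)
open import Data.Fin using (Fin)
open import Data.List using (List; []; _∷_; foldr; map; length)
open import Data.List.Relation.Unary.All using (All)
open import Data.List.Relation.Unary.Linked using (Linked)
open import Data.List.Relation.Binary.Pointwise using (Pointwise)
open import Data.List.Relation.Binary.Permutation.Propositional using (_↭_)
open import Data.Product using (_×_; _,_; proj₁; proj₂; ∃; ∃-syntax; Σ-syntax)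
open import Data.Sum using (_⊎_)
open import Data.Bool using (if_then_else_)
open import Relation.Nullary using (¬_)
open import Relation.Nullary.Decidable using (⌊_⌋)
open import Relation.Binary.PropositionalEquality using (_≡_)

module _ {c ℓ : Level} (R : CommutativeRing c ℓ) where
  open CommutativeRing R

  DividesR : Carrier → Carrier → Set (c ⊔ ℓ)
  DividesR a b = ∃[ q ] (b ≈ a * q)

  IsUnit : Carrier → Set (c ⊔ ℓ)
  IsUnit u = ∃[ v ] (u * v ≈ 1#)

  Associated : Carrier → Carrier → Set (c ⊔ ℓ)
  Associated a b = ∃[ u ] (IsUnit u × b ≈ a * u)

  IrreducibleElem : Carrier → Set (c ⊔ ℓ)
  IrreducibleElem x = (¬ x ≈ 0#) × (¬ IsUnit x) ×
    (∀ a b → x ≈ a * b → IsUnit a ⊎ IsUnit b)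

  PrimeElem : Carrier → Set (c ⊔ ℓ)
  PrimeElem p = (¬ p ≈ 0#) × (¬ IsUnit p) ×
    (∀ a b → DividesR p (a * b) → DividesR p a ⊎ DividesR p b)

  prodR : List Carrier → Carrier
  prodR = foldr _*_ 1#

  powR : Carrier → ℕ → Carrier
  powR x zero = 1#
  powR x (suc e) = x * powR x e

  IsIntegralDomain : Set (c ⊔ ℓ)
  IsIntegralDomain = (¬ 1# ≈ 0#) × (∀ a b → a * b ≈ 0# → a ≈ 0# ⊎ b ≈ 0#)

  IsUFD : Set (c ⊔ ℓ)
  IsUFD = IsIntegralDomain ×
    (∀ a → ¬ a ≈ 0# → ¬ IsUnit a →
       ∃[ xs ] (All IrreducibleElem xs × a ≈ prodR xs)) ×
    (∀ xs ys → All IrreducibleElem xs → All IrreducibleElem ys →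
       prodR xs ≈ prodR ys →
       ∃[ zs ] (zs ↭ ys × Pointwise Associated xs zs))

  IsValuation : Carrier → Carrier → ℕ → Set (c ⊔ ℓ)
  IsValuation p a e = DividesR (powR p e) a × ¬ DividesR (powR p (suc e)) a

  -- The quotient field Q(R): fractions (numerator , denominator), with
  -- denominators required nonzero, and the usual equality / operations.

  Frac : Set c
  Frac = Carrier × Carrier

  FracEq : Frac → Frac → Set ℓ
  FracEq (a , b) (a' , b') = a * b' ≈ a' * b

  _+F_ : Frac → Frac → Frac
  (a , b) +F (a' , b') = (a * b' + a' * b , b * b')

  _*F_ : Frac → Frac → Frac
  (a , b) *F (a' , b') = (a * a' , b * b')

  0F : Frac
  0F = (0# , 1#)

  -- A Dirichlet polynomial over Q(R): coefficients g i (i ≥ 1; g 0 unused),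
  -- denominators nonzero, finitely many nonzero coefficients.
  IsDirPolyQ : (ℕ → Frac) → Set ℓ
  IsDirPolyQ g = (∀ i → ¬ proj₂ (g i) ≈ 0#) ×
                 ∃[ N ] (∀ i → N < i → proj₁ (g i) ≈ 0#)

  NonConstantQ : (ℕ → Frac) → Set ℓ
  NonConstantQ g = ∃[ i ] (2 ≤ i × ¬ proj₁ (g i) ≈ 0#)

  dirMul : (ℕ → Frac) → (ℕ → Frac) → ℕ → Frac
  dirMul g h i = go i
    where
    go : ℕ → Frac
    go zero = 0F
    go (suc j) = (if ⌊ suc j ∣? i ⌋ then g (suc j) *F h (i Nat./ suc j) else 0F) +F go j

  IrreducibleOverQ : (ℕ → Carrier) → Set (c ⊔ ℓ)
  IrreducibleOverQ a = ¬ (∃[ g ] ∃[ h ] (IsDirPolyQ g × IsDirPolyQ h ×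
    NonConstantQ g × NonConstantQ h ×
    (∀ i → 1 ≤ i → FracEq (a i , 1#) (dirMul g h i))))

-- Newton log-polygon, stated with exact integer arithmetic.
-- Supp i : "a_i ≠ 0";  v i : the p-adic valuation of a_i.
-- The chord through (log i, v i), (log j, v j) (i < j) at abscissa log x
-- has value ≥ y  iff  v_i log j + v_j log x + y log i ≥ v_j log i + v_i log x + y log j
-- iff  j^{v_i} x^{v_j} i^y ≥ i^{v_j} x^{v_i} j^y  (after multiplying by log(j/i) > 0).

module _ {a : Level} (Supp : ℕ → Set a) (v : ℕ → ℕ) where
  open Nat using (_^_; _*_)

  ChordGE : ℕ → ℕ → ℕ → ℕ → Set
  ChordGE i j x y = i ^ v j * x ^ v i * j ^ y ≤ j ^ v i * x ^ v j * i ^ y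

  ChordEq : ℕ → ℕ → ℕ → ℕ → Set
  ChordEq i j x y = i ^ v j * x ^ v i * j ^ y ≡ j ^ v i * x ^ v j * i ^ y

  -- (log x , y) lies on the lower convex hull of {(log i, v i) : Supp i}:
  -- the hull's value at log x is the minimum of v x (if Supp x) and of all
  -- chord values over support pairs i < j with i ≤ x ≤ j.
  OnPolygon : ℕ → ℕ → Set a
  OnPolygon x y =
    ((Supp x × v x ≡ y) ⊎
     (∃[ i ] ∃[ j ] (Supp i × Supp j × i < j × i ≤ x × x ≤ j × ChordEq i j x y))) ×
    ((Supp x → y ≤ v x) ×
     (∀ i j → Supp i → Supp j → i < j → i ≤ x → x ≤ j → ChordGE i j x y))

  LogIntegralAt : ℕ → Set a
  LogIntegralAt x = ∃[ y ] OnPolygon x y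

  Segment : ℕ → ℕ → Set a
  Segment x x' = x < x' × LogIntegralAt x × LogIntegralAt x' ×
    (∀ z → x < z → z < x' → ¬ LogIntegralAt z)

  -- num/den is a product of relative degrees x'/x of a set of distinct segments
  -- (segments listed by strictly increasing left endpoint)
  SegmentProduct : ℕ → ℕ → Set a
  SegmentProduct num den = ∃[ segs ]
    (All (λ s → Segment (proj₁ s) (proj₂ s)) segs ×
     Linked (λ s t → proj₁ s < proj₁ t) segs ×
     num ≡ foldr _*_ 1 (map proj₂ segs) ×
     den ≡ foldr _*_ 1 (map proj₁ segs))

  -- the rational d/c belongs to S_p  (minus the S^1_rd condition)
  InProducts : ℕ → ℕ → Set a
  InProducts d c = ∃[ num ] ∃[ den ] (SegmentProduct num den × num * c ≡ den * d)

-- d/c ∈ S^1_rd(m,n):  d ∣ n, c ∣ m, 1 < d/c ≤ sqrt(n/m)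
InS1rd : ℕ → ℕ → ℕ → ℕ → Set
InS1rd m n d c = d ND.∣ n × c ND.∣ m × c < d × d Nat.* d Nat.* m ≤ n Nat.* c Nat.* c

{-# OPTIONS --safe #-}

-- Suppose f = g h with g and h nonconstant. For every prime the Newton log-polygon of f is the Minkowski sum of
-- those of g and h, up to a vertical shift that comes from clearing denominators. Walk along the polygons of g
-- and h simultaneously, always taking the edge of least slope among the next edge of g and the next edge of h.
-- The sum of the two current vertices stays on the polygon of f, so each edge of g, translated by the current
-- vertex of h, becomes a stretch of the polygon of f between two log-integral points, which cut it into whole
-- segments. The stretches follow each other from left to right, hence for every prime the product of the relative
-- degrees of all these segments is the ratio of the last to the first index of g; the same holds for h. One of
-- the two ratios is at most sqrt(n/m), and it exceeds 1 because a nonconstant monomial factor contradicts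
-- algebraic primitivity. Irreducibility being a negation, excluded middle may be used finitely many times.
--
-- Slopes (v' - v) / log(x'/x) are compared through integer powers, so no logarithm occurs.
module Submission where

open import Defs
open import Level using (Level)
open import Algebra.Bundles using (CommutativeRing)
open import Data.Nat using (ℕ; _≤_; _<_)
open import Data.Nat as ℕ using (zero; suc; z≤n; s≤s; NonZero)
import Data.Nat.Properties as ℕ
open import Data.Nat.Tactic.RingSolver using (solve-∀)
open import Data.Nat.Divisibility using (_∣_; _∣?_; m∣m*n)
open import Data.Nat.DivMod using (m*n/n≡m; m*[n/m]≡n)
open import Data.Bool using (true; false; if_then_else_)
open import Data.Fin using (Fin; zero; suc)
open import Data.List using ([]; _∷_; foldr; map; length)
open import Data.List.Relation.Unary.All as All using (All; []; _∷_)
open import Data.List.Relation.Unary.Linked using (Linked; []; [-]; _∷_)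
open import Data.Product using (_×_; _,_; proj₁; proj₂; ∃; ∃₂; ∃-syntax)
open import Data.Sum using (_⊎_; inj₁; inj₂; [_,_]′)
open import Data.Empty using (⊥; ⊥-elim)
open import Function using (_∘_)
open import Relation.Nullary using (¬_; yes; no)
open import Relation.Nullary.Decidable using (Dec; ⌊_⌋; map′; _×-dec_; ¬?)
open import Relation.Binary.Definitions using (tri<; tri≈; tri>)
open import Relation.Binary.PropositionalEquality as ≡ using (_≡_)

private variable
  c ℓ : Level

-- Fractions as logarithms: slopes and heights compared through integer powers.

module LogOrder where
  open import Data.Nat
  open import Data.Nat.Properties
  open import Data.Integer using (ℤ; +_; -[1+_]; _⊖_)
  open import Data.Integer.Properties using ([1+m]⊖[1+n]≡m⊖n)
  open ≡

  infix 4 _≲_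

  -- A pair `(a , b)` stands for the fraction a/b, or additively for log a - log b.
  _≲_ : ℕ × ℕ → ℕ × ℕ → Set
  (a , b) ≲ (c , d) = a * d ≤ c * b

  ≲-total : ∀ p q → p ≲ q ⊎ q ≲ p
  ≲-total (a , b) (c , d) = ≤-total (a * d) (c * b)

  swap-last : ∀ a b c → a * b * c ≡ a * c * b
  swap-last = solve-∀

  ≲-trans : ∀ {p q r} → NonZero (proj₂ q) → p ≲ q → q ≲ r → p ≲ r
  ≲-trans {a , b} {c , d} {e , f} d≢0 ad≤cb cf≤ed =
    *-cancelʳ-≤ (a * f) (e * b) d ⦃ d≢0 ⦄ (begin
      a * f * d ≡⟨ swap-last a f d ⟩
      a * d * f ≤⟨ *-monoˡ-≤ f ad≤cb ⟩
      c * b * f ≡⟨ swap-last c b f ⟩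
      c * f * b ≤⟨ *-monoˡ-≤ b cf≤ed ⟩
      e * d * b ≡⟨ swap-last e d b ⟩
      e * b * d ∎)
    where open ≤-Reasoning

  interchange : ∀ a b c d → a * b * (c * d) ≡ a * c * (b * d)
  interchange = solve-∀

  _∙_ : ℕ × ℕ → ℕ × ℕ → ℕ × ℕ
  (a , b) ∙ (c , d) = (a * c , b * d)

  ∙-mono-≲ : ∀ {p q r s} → p ≲ q → r ≲ s → p ∙ r ≲ q ∙ s
  ∙-mono-≲ {a , b} {c , d} {e , f} {g , h} p≲q r≲s =
    subst₂ _≤_ (interchange a d e h) (interchange c b g f) (*-mono-≤ p≲q r≲s)

  -- p + r ≤ q + s and s ≤ r give p ≤ q in the ordered group of logarithms.
  ∙-cancel-≲ : ∀ {p q r s} → NonZero (proj₁ s) → NonZero (proj₂ r) →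
               p ∙ r ≲ q ∙ s → s ≲ r → p ≲ q
  ∙-cancel-≲ {a , b} {c , d} {e , f} {g , h} g≢0 f≢0 pr≲qs s≲r =
    *-cancelʳ-≤ (a * d) (c * b) (g * f) ⦃ m*n≢0 g f ⦃ g≢0 ⦄ ⦃ f≢0 ⦄ ⦄ (begin
      a * d * (g * f) ≤⟨ *-monoʳ-≤ (a * d) s≲r ⟩
      a * d * (e * h) ≡⟨ interchange a d e h ⟩
      a * e * (d * h) ≤⟨ pr≲qs ⟩
      c * g * (b * f) ≡⟨ interchange c g b f ⟩
      c * b * (g * f) ∎)
    where open ≤-Reasoning

  ^-cancelʳ-≤ : ∀ {a b} n → a ^ suc n ≤ b ^ suc n → a ≤ b
  ^-cancelʳ-≤ {a} {b} n aⁿ≤bⁿ with ≤-<-connex a b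
  ... | inj₁ a≤b = a≤b
  ... | inj₂ b<a = ⊥-elim (<⇒≱ (^-monoˡ-< (suc n) b<a) aⁿ≤bⁿ)

  pow : ℕ × ℕ → ℤ → ℕ × ℕ
  pow (a , b) (+ n) = (a ^ n , b ^ n)
  pow (a , b) -[1+ n ] = (b ^ suc n , a ^ suc n)

  ^-swap : ∀ a m n → (a ^ m) ^ n ≡ (a ^ n) ^ m
  ^-swap a m n = trans (^-*-assoc a m n) (trans (cong (a ^_) (*-comm m n)) (sym (^-*-assoc a n m)))

  ^-distrib-* : ∀ n a b → (a * b) ^ n ≡ a ^ n * b ^ n
  ^-distrib-* zero a b = refl
  ^-distrib-* (suc n) a b =
    trans (cong (a * b *_) (^-distrib-* n a b)) (interchange a b (a ^ n) (b ^ n))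

  ≲-pow : ∀ {p q} n → p ≲ q → pow p (+ n) ≲ pow q (+ n)
  ≲-pow {a , b} {c , d} n p≲q =
    subst₂ _≤_ (^-distrib-* n a d) (^-distrib-* n c b) (^-monoˡ-≤ n p≲q)

  ≲-root : ∀ {p q} n → pow p (+ suc n) ≲ pow q (+ suc n) → p ≲ q
  ≲-root {a , b} {c , d} n pⁿ≲qⁿ = ^-cancelʳ-≤ n
    (subst₂ _≤_ (sym (^-distrib-* (suc n) a d)) (sym (^-distrib-* (suc n) c b)) pⁿ≲qⁿ)

  -- With Lᵢ the logarithm of `lᵢ`, the hypotheses read n₁L₂ ≤ (n₂+1)L₁ and (n₂+1)L₃ ≤ n₃L₂. Scaled
  -- by n₃ and n₁ they meet in n₁n₃L₂, and the positive factor n₂+1 cancels.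
  pow-≲-trans⁺ : ∀ {l₁ l₂ l₃} → NonZero (proj₂ l₂) → ∀ n₁ n₂ n₃ →
    pow l₂ (+ n₁) ≲ pow l₁ (+ suc n₂) → pow l₃ (+ suc n₂) ≲ pow l₂ (+ n₃) →
    pow l₃ (+ n₁) ≲ pow l₁ (+ n₃)
  pow-≲-trans⁺ {a₁ , b₁} {a₂ , b₂} {a₃ , b₃} b₂≢0 n₁ n₂ n₃ h h′ =
    ≲-root {a₃ ^ n₁ , b₃ ^ n₁} {a₁ ^ n₃ , b₁ ^ n₃} n₂
      (subst₂ _≲_ (cong₂ _,_ (^-swap a₃ (suc n₂) n₁) (^-swap b₃ (suc n₂) n₁))
                  (cong₂ _,_ (^-swap a₁ (suc n₂) n₃) (^-swap b₁ (suc n₂) n₃))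
        (≲-trans {(a₃ ^ suc n₂) ^ n₁ , (b₃ ^ suc n₂) ^ n₁} {(a₂ ^ n₃) ^ n₁ , (b₂ ^ n₃) ^ n₁}
                 {(a₁ ^ suc n₂) ^ n₃ , (b₁ ^ suc n₂) ^ n₃}
          (m^n≢0 (b₂ ^ n₃) n₁ ⦃ m^n≢0 b₂ n₃ ⦃ b₂≢0 ⦄ ⦄)
          (≲-pow {a₃ ^ suc n₂ , b₃ ^ suc n₂} {a₂ ^ n₃ , b₂ ^ n₃} n₁ h′)
          (subst (_≲ ((a₁ ^ suc n₂) ^ n₃ , (b₁ ^ suc n₂) ^ n₃))
                 (cong₂ _,_ (^-swap a₂ n₁ n₃) (^-swap b₂ n₁ n₃))
            (≲-pow {a₂ ^ n₁ , b₂ ^ n₁} {a₁ ^ suc n₂ , b₁ ^ suc n₂} n₃ h))))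

  -- This is transitivity of the slopes nᵢ / log(aᵢ/bᵢ), by cases on the signs of the exponents. The
  -- positive middle run excludes the inconsistent sign patterns; the outer chords may be vertical.
  pow-≲-trans : ∀ {a₁ b₁ a₂ b₂ a₃ b₃} → NonZero b₁ → NonZero b₂ → NonZero b₃ →
    b₁ ≤ a₁ → b₂ < a₂ → b₃ ≤ a₃ → ∀ n₁ n₂ n₃ →
    pow (a₂ , b₂) n₁ ≲ pow (a₁ , b₁) n₂ → pow (a₃ , b₃) n₂ ≲ pow (a₂ , b₂) n₃ →
    pow (a₃ , b₃) n₁ ≲ pow (a₁ , b₁) n₃
  pow-≲-trans {a₁} {b₁} {a₂} {b₂} {a₃} {b₃} b₁≢0 b₂≢0 b₃≢0 b₁≤a₁ b₂<a₂ b₃≤a₃ = go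
    where
    strict : ∀ {a b} → NonZero b → b ≤ a → ∀ i j → b₂ ^ suc i * b ^ j < a₂ ^ suc i * a ^ j
    strict {a} {b} b≢0 b≤a i j =
      ≤-<-trans (*-monoʳ-≤ (b₂ ^ suc i) (^-monoˡ-≤ j b≤a))
                (*-monoˡ-< (a ^ j) ⦃ m^n≢0 a j ⦃ >-nonZero (≤-trans (>-nonZero⁻¹ b ⦃ b≢0 ⦄) b≤a) ⦄ ⦄
                  (^-monoˡ-< (suc i) b₂<a₂))

    nonneg : ∀ n → b₁ ^ n ≤ a₁ ^ n
    nonneg n = ^-monoˡ-≤ n b₁≤a₁

    go : ∀ n₁ n₂ n₃ → pow (a₂ , b₂) n₁ ≲ pow (a₁ , b₁) n₂ → pow (a₃ , b₃) n₂ ≲ pow (a₂ , b₂) n₃ →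
         pow (a₃ , b₃) n₁ ≲ pow (a₁ , b₁) n₃
    go (+ zero) _ (+ n₃) _ _ = subst₂ _≤_ (sym (*-identityˡ _)) (sym (*-identityʳ _)) (nonneg n₃)
    go -[1+ n₁ ] _ (+ n₃) _ _ =
      subst (b₃ ^ suc n₁ * b₁ ^ n₃ ≤_) (*-comm (a₃ ^ suc n₁) (a₁ ^ n₃))
        (*-mono-≤ (^-monoˡ-≤ (suc n₁) b₃≤a₃) (nonneg n₃))
    go (+ suc n₁) (+ zero) (+ n₃) h _ =
      ⊥-elim (<⇒≱ (^-monoˡ-< (suc n₁) b₂<a₂) (subst₂ _≤_ (*-identityʳ _) (*-identityˡ _) h))
    go (+ suc n₁) (+ suc n₂) (+ n₃) h h′ =
      pow-≲-trans⁺ {a₁ , b₁} {a₂ , b₂} {a₃ , b₃} b₂≢0 (suc n₁) n₂ n₃ h h′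
    go (+ suc n₁) -[1+ n₂ ] _ h _ =
      ⊥-elim (<⇒≱ (strict b₁≢0 b₁≤a₁ n₁ (suc n₂))
        (subst (a₂ ^ suc n₁ * a₁ ^ suc n₂ ≤_) (*-comm (b₁ ^ suc n₂) (b₂ ^ suc n₁)) h))
    go _ (+ n₂) -[1+ n₃ ] _ h′ =
      ⊥-elim (<⇒≱ (strict b₃≢0 b₃≤a₃ n₃ n₂)
        (subst (_≤ b₂ ^ suc n₃ * b₃ ^ n₂) (*-comm (a₃ ^ n₂) (a₂ ^ suc n₃)) h′))
    -- Negating all three slopes reverses the chain, which reduces the remaining cases to
    -- `pow-≲-trans⁺`.
    go (+ zero) -[1+ n₂ ] -[1+ n₃ ] h h′ = dual zero n₂ n₃ h h′
      where
      dual : ∀ n₁ n₂ n₃ → b₂ ^ n₁ * a₁ ^ suc n₂ ≤ b₁ ^ suc n₂ * a₂ ^ n₁ →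
             b₃ ^ suc n₂ * a₂ ^ suc n₃ ≤ b₂ ^ suc n₃ * a₃ ^ suc n₂ →
             b₃ ^ n₁ * a₁ ^ suc n₃ ≤ b₁ ^ suc n₃ * a₃ ^ n₁
      dual n₁ n₂ n₃ h h′ =
        subst₂ _≤_ (*-comm (a₁ ^ suc n₃) (b₃ ^ n₁)) (*-comm (a₃ ^ n₁) (b₁ ^ suc n₃))
        (pow-≲-trans⁺ {a₃ , b₃} {a₂ , b₂} {a₁ , b₁} b₂≢0 (suc n₃) n₂ n₁
          (subst₂ _≤_ (*-comm (b₃ ^ suc n₂) (a₂ ^ suc n₃)) (*-comm (b₂ ^ suc n₃) (a₃ ^ suc n₂)) h′)
          (subst₂ _≤_ (*-comm (b₂ ^ n₁) (a₁ ^ suc n₂)) (*-comm (b₁ ^ suc n₂) (a₂ ^ n₁)) h))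
    go -[1+ n₁ ] -[1+ n₂ ] -[1+ n₃ ] h h′ =
        subst₂ _≤_ (*-comm (a₁ ^ suc n₃) (b₃ ^ suc n₁)) (*-comm (a₃ ^ suc n₁) (b₁ ^ suc n₃))
        (pow-≲-trans⁺ {a₃ , b₃} {a₂ , b₂} {a₁ , b₁} b₂≢0 (suc n₃) n₂ (suc n₁)
          (subst₂ _≤_ (*-comm (b₃ ^ suc n₂) (a₂ ^ suc n₃)) (*-comm (b₂ ^ suc n₃) (a₃ ^ suc n₂)) h′)
          (subst₂ _≤_ (*-comm (b₂ ^ suc n₁) (a₁ ^ suc n₂)) (*-comm (b₁ ^ suc n₂) (a₂ ^ suc n₁)) h))

  infix 4 _≃_ _≼_

  _≃_ : ℕ × ℕ → ℕ × ℕ → Set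
  (a , b) ≃ (c , d) = a * d ≡ c * b

  ≲-resp-≃ : ∀ {p q r s} → NonZero (proj₂ p) → NonZero (proj₂ q) → p ≃ r → q ≃ s → p ≲ q → r ≲ s
  ≲-resp-≃ {p} {q} {r} {s} p≢0 q≢0 p≃r q≃s p≲q =
    ≲-trans {r} {p} {s} p≢0 (≤-reflexive (sym p≃r))
      (≲-trans {p} {q} {s} q≢0 p≲q (≤-reflexive q≃s))

  -- This links differences of valuations, which may be negative, to products of natural powers.
  pow-⊖ : ∀ a b m n → pow (a , b) (m ⊖ n) ≃ (a ^ m * b ^ n , b ^ m * a ^ n)
  pow-⊖ a b m zero = comm (a ^ m) (b ^ m)
    where
    comm : ∀ u v → u * (v * 1) ≡ u * 1 * v
    comm = solve-∀
  pow-⊖ a b zero (suc n) = comm (b * b ^ n) (a * a ^ n)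
    where
    comm : ∀ u v → u * (1 * v) ≡ 1 * u * v
    comm = solve-∀
  pow-⊖ a b (suc m) (suc n) rewrite [1+m]⊖[1+n]≡m⊖n m n =
    trans (factor u b (b ^ m) a (a ^ n))
      (trans (cong (a * b *_) (pow-⊖ a b m n)) (sym (factor′ a (a ^ m) b (b ^ n) v)))
    where
    u v : ℕ
    u = proj₁ (pow (a , b) (m ⊖ n))
    v = proj₂ (pow (a , b) (m ⊖ n))

    factor : ∀ u b bᵐ a aⁿ → u * (b * bᵐ * (a * aⁿ)) ≡ a * b * (u * (bᵐ * aⁿ))
    factor = solve-∀

    factor′ : ∀ a aᵐ b bⁿ v → a * aᵐ * (b * bⁿ) * v ≡ a * b * (aᵐ * bⁿ * v)
    factor′ = solve-∀

  -- With P = (log a, u), Q = (log b, w) and R = (log x, y), the fraction stands for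
  -- exp (y (log b - log a) - (w - u) log x): the height of R measured along the direction PQ.
  φ : ℕ × ℕ → ℕ × ℕ → ℕ × ℕ → ℕ × ℕ
  φ (a , u) (b , w) (x , y) = (b ^ y * x ^ u , a ^ y * x ^ w)

  ^*^-nonZero : ∀ {a b} → NonZero a → NonZero b → ∀ m n → NonZero (a ^ m * b ^ n)
  ^*^-nonZero {a} {b} a≢0 b≢0 m n = m*n≢0 (a ^ m) (b ^ n) ⦃ m^n≢0 a m ⦃ a≢0 ⦄ ⦄ ⦃ m^n≢0 b n ⦃ b≢0 ⦄ ⦄

  -- The slope of the chord RS is at most that of PQ when log R ≤ log S, and at least that of PQ
  -- when log S ≤ log R; in either case S is no higher than R measured along PQ.
  record _≼_ (ρ σ : (ℕ × ℕ) × (ℕ × ℕ)) : Set where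
    constructor mk≼
    field un≼ : φ (proj₁ σ) (proj₂ σ) (proj₂ ρ) ≲ φ (proj₁ σ) (proj₂ σ) (proj₁ ρ)

  open _≼_ public

  ≼-refl : ∀ {R σ} → (R , R) ≼ σ
  ≼-refl = mk≼ ≤-refl

  ≼-total : ∀ R S {σ} → (R , S) ≼ σ ⊎ (S , R) ≼ σ
  ≼-total R S {P , Q} with ≲-total (φ P Q S) (φ P Q R)
  ... | inj₁ h = inj₁ (mk≼ h)
  ... | inj₂ h = inj₂ (mk≼ h)

  ≼-chain : ∀ {R S V P Q} → NonZero (proj₁ P) → NonZero (proj₁ Q) → NonZero (proj₁ S) →
            (R , S) ≼ (P , Q) → (S , V) ≼ (P , Q) → (R , V) ≼ (P , Q)
  ≼-chain {R} {S} {V} {a , u} {b , w} a≢0 b≢0 S≢0 (mk≼ h) (mk≼ h′) =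
    mk≼ (≲-trans {φ (a , u) (b , w) V} {φ (a , u) (b , w) S} {φ (a , u) (b , w) R}
      (^*^-nonZero a≢0 S≢0 (proj₂ S) w) h′ h)

  -- Both inequalities consist of the same eight powers, regrouped. The two readings are: Q is no
  -- higher than P along RS, and R is no higher than S along PQ.
  ≼-flip : ∀ {P Q R S} → (P , Q) ≼ (R , S) → (S , R) ≼ (P , Q)
  ≼-flip {a , u} {b , w} {c , u′} {d , w′} (mk≼ h) =
    mk≼ (subst₂ _≤_ (reorder (d ^ w) (b ^ u′) (c ^ u) (a ^ w′)) (reorder′ (d ^ u) (a ^ u′) (c ^ w) (b ^ w′)) h)
    where
    reorder : ∀ p q r s → p * q * (r * s) ≡ q * r * (s * p)
    reorder = solve-∀
    reorder′ : ∀ p q r s → p * q * (r * s) ≡ s * p * (q * r)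
    reorder′ = solve-∀

  ≼-unflip : ∀ {P Q R S} → (S , R) ≼ (P , Q) → (P , Q) ≼ (R , S)
  ≼-unflip {a , u} {b , w} {c , u′} {d , w′} (mk≼ h) =
    mk≼ (subst₂ _≤_ (reorder (b ^ u′) (c ^ u) (a ^ w′) (d ^ w)) (reorder′ (b ^ w′) (d ^ u) (a ^ u′) (c ^ w)) h)
    where
    reorder : ∀ p q r s → p * q * (r * s) ≡ s * p * (q * r)
    reorder = solve-∀
    reorder′ : ∀ p q r s → p * q * (r * s) ≡ q * r * (s * p)
    reorder′ = solve-∀

  pow-nonZero : ∀ {a b} → NonZero a → NonZero b → ∀ n → NonZero (proj₂ (pow (a , b) n))
  pow-nonZero {b = b} _ b≢0 (+ n) = m^n≢0 b n ⦃ b≢0 ⦄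
  pow-nonZero {a} a≢0 _ -[1+ n ] = m^n≢0 a (suc n) ⦃ a≢0 ⦄

  module _ {a b c d u w u′ w′ : ℕ} (a≢0 : NonZero a) (b≢0 : NonZero b) (c≢0 : NonZero c) (d≢0 : NonZero d) where

    -- The factors regroup so that the rise of each chord meets the run of the other: (w - u)
    -- log(d/c) ≤ (w' - u') log(b/a).
    ≼⇒pow : ((a , u) , (b , w)) ≼ ((c , u′) , (d , w′)) →
            pow (d , c) (w ⊖ u) ≲ pow (b , a) (w′ ⊖ u′)
    ≼⇒pow (mk≼ h) = ≲-resp-≃ {d ^ w * c ^ u , c ^ w * d ^ u} {b ^ w′ * a ^ u′ , a ^ w′ * b ^ u′}
      {pow (d , c) (w ⊖ u)} {pow (b , a) (w′ ⊖ u′)}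
      (^*^-nonZero c≢0 d≢0 w u) (^*^-nonZero a≢0 b≢0 w′ u′)
      (sym (pow-⊖ d c w u)) (sym (pow-⊖ b a w′ u′))
      (subst₂ _≤_ (reorder (d ^ w) (b ^ u′) (c ^ u) (a ^ w′)) (reorder′ (d ^ u) (a ^ u′) (c ^ w) (b ^ w′)) h)
      where
      reorder : ∀ p q r s → p * q * (r * s) ≡ p * r * (s * q)
      reorder = solve-∀
      reorder′ : ∀ p q r s → p * q * (r * s) ≡ s * q * (r * p)
      reorder′ = solve-∀

    pow⇒≼ : pow (d , c) (w ⊖ u) ≲ pow (b , a) (w′ ⊖ u′) →
            ((a , u) , (b , w)) ≼ ((c , u′) , (d , w′))
    pow⇒≼ h = mk≼ (subst₂ _≤_ (reorder (d ^ w) (b ^ u′) (c ^ u) (a ^ w′)) (reorder′ (d ^ u) (a ^ u′) (c ^ w) (b ^ w′))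
      (≲-resp-≃ {pow (d , c) (w ⊖ u)} {pow (b , a) (w′ ⊖ u′)} {d ^ w * c ^ u , c ^ w * d ^ u}
        {b ^ w′ * a ^ u′ , a ^ w′ * b ^ u′}
        (pow-nonZero d≢0 c≢0 (w ⊖ u)) (pow-nonZero b≢0 a≢0 (w′ ⊖ u′)) (pow-⊖ d c w u) (pow-⊖ b a w′ u′) h))
      where
      reorder : ∀ p q r s → p * r * (s * q) ≡ p * q * (r * s)
      reorder = solve-∀
      reorder′ : ∀ p q r s → s * q * (r * p) ≡ p * q * (r * s)
      reorder′ = solve-∀

  nonZero-≤ : ∀ {a b} → NonZero a → a ≤ b → NonZero b
  nonZero-≤ {a} a≢0 a≤b = >-nonZero (≤-trans (>-nonZero⁻¹ a ⦃ a≢0 ⦄) a≤b)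

  -- `≼-chain` adds height differences along one fixed direction; here the direction itself changes,
  -- and the middle chord must be nonvertical to carry the comparison.
  ≼-trans : ∀ {P Q R S V W} → NonZero (proj₁ P) → NonZero (proj₁ R) → NonZero (proj₁ V) →
    proj₁ P ≤ proj₁ Q → proj₁ R < proj₁ S → proj₁ V ≤ proj₁ W →
    (P , Q) ≼ (R , S) → (R , S) ≼ (V , W) → (P , Q) ≼ (V , W)
  ≼-trans {a₁ , u₁} {b₁ , w₁} {a₂ , u₂} {b₂ , w₂} {a₃ , u₃} {b₃ , w₃} P≢0 R≢0 V≢0 P≤Q R<S V≤W h h′ =
    pow⇒≼ {u = u₁} {w₁} {u₃} {w₃} P≢0 Q≢0 V≢0 W≢0
      (pow-≲-trans P≢0 R≢0 V≢0 P≤Q R<S V≤W (w₁ ⊖ u₁) (w₂ ⊖ u₂) (w₃ ⊖ u₃)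
        (≼⇒pow {u = u₁} {w₁} {u₂} {w₂} P≢0 Q≢0 R≢0 S≢0 h)
        (≼⇒pow {u = u₂} {w₂} {u₃} {w₃} R≢0 S≢0 V≢0 W≢0 h′))
    where
    Q≢0 = nonZero-≤ P≢0 P≤Q
    S≢0 = nonZero-≤ R≢0 (<⇒≤ R<S)
    W≢0 = nonZero-≤ V≢0 V≤W

  -- Multiplying indices while adding valuations is addition of points in logarithmic coordinates,
  -- and the height along a direction is linear.
  φ-∙ : ∀ P Q x y x′ y′ → φ P Q (x * x′ , y + y′) ≡ φ P Q (x , y) ∙ φ P Q (x′ , y′)
  φ-∙ (a , u) (b , w) x y x′ y′ = cong₂ _,_ (split b u) (split a w)
    where
    split : ∀ c v → c ^ (y + y′) * (x * x′) ^ v ≡ c ^ y * x ^ v * (c ^ y′ * x′ ^ v)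
    split c v = trans (cong₂ _*_ (^-distribˡ-+-* c y y′) (^-distrib-* v x x′))
                      (interchange (c ^ y) (c ^ y′) (x ^ v) (x′ ^ v))

  _≼?_ : ∀ ρ σ → Dec (ρ ≼ σ)
  ρ ≼? σ = map′ mk≼ un≼ (_ ≤? _)

  ≼-connex : ∀ ρ σ → ρ ≼ σ ⊎ σ ≼ ρ
  ≼-connex (R , S) σ with ≼-total R S {σ}
  ... | inj₁ h = inj₁ h
  ... | inj₂ h = inj₂ (≼-unflip h)

  ≼-∙ : ∀ {x y x′ y′ u v u′ v′ σ} → ((x , y) , (u , v)) ≼ σ → ((x′ , y′) , (u′ , v′)) ≼ σ →
        ((x * x′ , y + y′) , (u * u′ , v + v′)) ≼ σ
  ≼-∙ {x} {y} {x′} {y′} {u} {v} {u′} {v′} {P , Q} (mk≼ h) (mk≼ h′) =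
    mk≼ (subst₂ _≲_ (sym (φ-∙ P Q u v u′ v′)) (sym (φ-∙ P Q x y x′ y′))
      (∙-mono-≲ {φ P Q (u , v)} {φ P Q (x , y)} {φ P Q (u′ , v′)} {φ P Q (x′ , y′)} h h′))

  -- The sum does not rise while its second summand does not fall, so the first summand cannot rise.
  ≼-∙-cancel : ∀ {x y x′ y′ u v u′ v′ P Q} → NonZero (proj₁ P) → NonZero (proj₁ Q) → NonZero x′ → NonZero u′ →
    ((x * x′ , y + y′) , (u * u′ , v + v′)) ≼ (P , Q) → ((u′ , v′) , (x′ , y′)) ≼ (P , Q) →
    ((x , y) , (u , v)) ≼ (P , Q)
  ≼-∙-cancel {x} {y} {x′} {y′} {u} {v} {u′} {v′} {P} {Q} P≢0 Q≢0 x′≢0 u′≢0 (mk≼ h) (mk≼ h′) =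
    mk≼ (∙-cancel-≲ {φ P Q (u , v)} {φ P Q (x , y)} {φ P Q (u′ , v′)} {φ P Q (x′ , y′)}
      (^*^-nonZero Q≢0 x′≢0 y′ (proj₂ P)) (^*^-nonZero P≢0 u′≢0 v′ (proj₂ Q))
      (subst₂ _≲_ (φ-∙ P Q u v u′ v′) (φ-∙ P Q x y x′ y′) h) h′)

  ≼-shift : ∀ {x y u v δ P Q} → NonZero (proj₁ P) → NonZero (proj₁ Q) →
    ((x , y + δ) , (u , v + δ)) ≼ (P , Q) → ((x , y) , (u , v)) ≼ (P , Q)
  -- Index 1 has logarithm 0, so adding the point (1, δ) is a vertical shift.
  ≼-shift {x} {y} {u} {v} {δ} {P} {Q} P≢0 Q≢0 h = ≼-∙-cancel {x′ = 1} {y′ = δ} {u′ = 1} {v′ = δ} P≢0 Q≢0 _ _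
    (subst₂ (λ x u → ((x , y + δ) , (u , v + δ)) ≼ (P , Q)) (sym (*-identityʳ x)) (sym (*-identityʳ u)) h) ≼-refl

  exchange-≤ : ∀ {a b m n} → a ≤ b → m ≤ n → b ^ m * a ^ n ≤ b ^ n * a ^ m
  exchange-≤ {a} {b} {m} {n} a≤b m≤n with n ∸ m | m+[n∸m]≡n m≤n
  ... | k | refl = begin
    b ^ m * a ^ (m + k)     ≡⟨ cong (b ^ m *_) (^-distribˡ-+-* a m k) ⟩
    b ^ m * (a ^ m * a ^ k) ≤⟨ *-monoʳ-≤ (b ^ m) (*-monoʳ-≤ (a ^ m) (^-monoˡ-≤ k a≤b)) ⟩
    b ^ m * (a ^ m * b ^ k) ≡⟨ reorder (b ^ m) (a ^ m) (b ^ k) ⟩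
    b ^ m * b ^ k * a ^ m   ≡⟨ cong (_* a ^ m) (^-distribˡ-+-* b m k) ⟨
    b ^ (m + k) * a ^ m     ∎
    where
    open ≤-Reasoning
    reorder : ∀ p q r → p * (q * r) ≡ p * r * q
    reorder = solve-∀

  exchange-cancel-≤ : ∀ {a b m n} → NonZero a → a < b → b ^ m * a ^ n ≤ b ^ n * a ^ m → m ≤ n
  exchange-cancel-≤ {a} {b} {m} {n} a≢0 a<b h with ≤-<-connex m n
  ... | inj₁ m≤n = m≤n
  ... | inj₂ n<m with m ∸ suc n | m+[n∸m]≡n n<m
  ...   | k | refl = ⊥-elim (<⇒≱ (^-monoˡ-< (suc k) a<b)
    (*-cancelˡ-≤ (b ^ n * a ^ n) ⦃ ^*^-nonZero (nonZero-≤ a≢0 (<⇒≤ a<b)) a≢0 n n ⦄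
      (subst₂ _≤_ (expand b) (expand′ a) h)))
    where
    reorder : ∀ p q r → p * q * r ≡ p * r * q
    reorder = solve-∀

    split : ∀ c → c ^ suc (n + k) ≡ c ^ n * c ^ suc k
    split c = trans (cong (c ^_) (sym (+-suc n k))) (^-distribˡ-+-* c n (suc k))

    expand : ∀ c → c ^ suc (n + k) * a ^ n ≡ c ^ n * a ^ n * c ^ suc k
    expand c = trans (cong (_* a ^ n) (split c)) (reorder (c ^ n) (c ^ suc k) (a ^ n))

    expand′ : ∀ c → b ^ n * c ^ suc (n + k) ≡ b ^ n * c ^ n * c ^ suc k
    expand′ c = trans (cong (b ^ n *_) (split c)) (sym (*-assoc (b ^ n) (c ^ n) (c ^ suc k)))

  vertical : ∀ {x y y′ P Q} → proj₁ P ≤ proj₁ Q → y ≤ y′ → ((x , y′) , (x , y)) ≼ (P , Q)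
  vertical {x} {y} {y′} {a , u} {b , w} a≤b y≤y′ = mk≼ (subst₂ _≤_
    (interchange (b ^ y) (a ^ y′) (x ^ u) (x ^ w)) (interchange (b ^ y′) (a ^ y) (x ^ u) (x ^ w))
    (*-monoˡ-≤ (x ^ u * x ^ w) (exchange-≤ a≤b y≤y′)))

  vertical-cancel : ∀ {x y y′ P Q} → NonZero x → NonZero (proj₁ P) → proj₁ P < proj₁ Q →
    ((x , y′) , (x , y)) ≼ (P , Q) → y ≤ y′
  vertical-cancel {x} {y} {y′} {a , u} {b , w} x≢0 a≢0 a<b (mk≼ h) = exchange-cancel-≤ a≢0 a<b
    (*-cancelʳ-≤ (b ^ y * a ^ y′) (b ^ y′ * a ^ y) (x ^ u * x ^ w) ⦃ ^*^-nonZero x≢0 x≢0 u w ⦄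
      (subst₂ _≤_ (interchange (b ^ y) (x ^ u) (a ^ y′) (x ^ w)) (interchange (b ^ y′) (x ^ u) (a ^ y) (x ^ w)) h))

  horizontal-↑ : ∀ {x x′ y P Q} → x ≤ x′ → proj₂ P ≤ proj₂ Q → ((x , y) , (x′ , y)) ≼ (P , Q)
  horizontal-↑ {x} {x′} {y} {a , u} {b , w} x≤x′ u≤w = mk≼ (subst₂ _≤_
    (interchange (b ^ y) (a ^ y) (x′ ^ u) (x ^ w))
    (trans (cong (b ^ y * a ^ y *_) (*-comm (x′ ^ w) (x ^ u))) (interchange (b ^ y) (a ^ y) (x ^ u) (x′ ^ w)))
    (*-monoʳ-≤ (b ^ y * a ^ y) (exchange-≤ x≤x′ u≤w)))

  horizontal-↓ : ∀ {x x′ y P Q} → x ≤ x′ → proj₂ Q ≤ proj₂ P → ((x′ , y) , (x , y)) ≼ (P , Q)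
  horizontal-↓ {x} {x′} {y} {a , u} {b , w} x≤x′ w≤u = mk≼ (subst₂ _≤_
    (trans (cong (b ^ y * a ^ y *_) (*-comm (x′ ^ w) (x ^ u))) (interchange (b ^ y) (a ^ y) (x ^ u) (x′ ^ w)))
    (interchange (b ^ y) (a ^ y) (x′ ^ u) (x ^ w))
    (*-monoʳ-≤ (b ^ y * a ^ y) (exchange-≤ x≤x′ w≤u)))

-- Bounded search for extremal indices.

module NewtonPolygon where
  open LogOrder
  open import Data.Nat
  open import Data.Nat.Properties
  open import Data.Nat.Induction using (<-wellFounded; Acc; acc)
  open ≡

  module _ {C : ℕ → Set ℓ} (C? : ∀ i → Dec (C i)) (_⊑_ : ℕ → ℕ → Set)
           (⊑-total : ∀ i j → i ⊑ j ⊎ j ⊑ i)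
           (⊑-trans : ∀ {i j k} → C i → C j → C k → i ⊑ j → j ⊑ k → i ⊑ k) where

    -- Transitivity is asked for on `C` alone, because slopes compare transitively only across
    -- nonvertical chords.
    minimum : ∀ N → (∀ i → i < N → ¬ C i) ⊎ ∃ λ i → C i × (∀ j → j < N → C j → i ⊑ j)
    minimum zero = inj₁ λ _ ()
    minimum (suc N) with C? N | minimum N
    ... | no ¬c | inj₁ none = inj₁ none′
      where
      none′ : ∀ i → i < suc N → ¬ C i
      none′ i i≤N with m<1+n⇒m<n∨m≡n i≤N
      ... | inj₁ i<N = none i i<N
      ... | inj₂ refl = ¬c
    ... | no ¬c | inj₂ (i , c , least) = inj₂ (i , c , least′)
      where
      least′ : ∀ j → j < suc N → C j → i ⊑ j
      least′ j j≤N with m<1+n⇒m<n∨m≡n j≤N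
      ... | inj₁ j<N = least j j<N
      ... | inj₂ refl = λ c′ → ⊥-elim (¬c c′)
    ... | yes c | inj₁ none = inj₂ (N , c , least′)
      where
      least′ : ∀ j → j < suc N → C j → N ⊑ j
      least′ j j≤N c′ with m<1+n⇒m<n∨m≡n j≤N
      ... | inj₁ j<N = ⊥-elim (none j j<N c′)
      ... | inj₂ refl with ⊑-total j j
      ...   | inj₁ h = h
      ...   | inj₂ h = h
    ... | yes c | inj₂ (i , cᵢ , least) with ⊑-total i N
    ...   | inj₁ i⊑N = inj₂ (i , cᵢ , least′)
      where
      least′ : ∀ j → j < suc N → C j → i ⊑ j
      least′ j j≤N c′ with m<1+n⇒m<n∨m≡n j≤N
      ... | inj₁ j<N = least j j<N c′
      ... | inj₂ refl = i⊑N
    ...   | inj₂ N⊑i = inj₂ (N , c , least′)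
      where
      least′ : ∀ j → j < suc N → C j → N ⊑ j
      least′ j j≤N c′ with m<1+n⇒m<n∨m≡n j≤N
      ... | inj₁ j<N = ⊑-trans c cᵢ c′ N⊑i (least j j<N c′)
      ... | inj₂ refl with ⊑-total j j
      ...   | inj₁ h = h
      ...   | inj₂ h = h

  least : ∀ {C : ℕ → Set ℓ} → (∀ i → Dec (C i)) → ∀ N → (∀ i → C i → i < N) → ∀ i → C i →
          ∃ λ j → C j × (∀ k → C k → j ≤ k)
  least C? N C<N i cᵢ with minimum C? _≤_ ≤-total (λ _ _ _ → ≤-trans) N
  ... | inj₁ none = ⊥-elim (none i (C<N i cᵢ) cᵢ)
  ... | inj₂ (j , cⱼ , j≤) = j , cⱼ , λ k cₖ → j≤ k (C<N k cₖ) cₖ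

  greatest : ∀ {C : ℕ → Set ℓ} → (∀ i → Dec (C i)) → ∀ N → (∀ i → C i → i < N) → ∀ i → C i →
             ∃ λ j → C j × (∀ k → C k → k ≤ j)
  greatest C? N C<N i cᵢ with minimum C? _≥_ (λ i j → ≤-total j i) (λ _ _ _ p q → ≤-trans q p) N
  ... | inj₁ none = ⊥-elim (none i (C<N i cᵢ) cᵢ)
  ... | inj₂ (j , cⱼ , j≥) = j , cⱼ , λ k cₖ → j≥ k (C<N k cₖ) cₖ

  -- Segments between log-integral points.

  module Segments (S : ℕ → Set ℓ) (v : ℕ → ℕ) (L? : ∀ x → Dec (LogIntegralAt S v x)) where

    -- The rational d/c is a product of relative degrees of distinct segments at or to the right of log x.
    SegmentsFrom : ℕ → ℕ → ℕ → Set ℓ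
    SegmentsFrom x d c = ∃ λ segs →
      All (λ s → Segment S v (proj₁ s) (proj₂ s)) segs ×
      Linked (λ s t → proj₁ s < proj₁ t) segs ×
      All (λ s → x ≤ proj₁ s) segs ×
      foldr _*_ 1 (map proj₂ segs) * c ≡ foldr _*_ 1 (map proj₁ segs) * d

    weaken : ∀ {x x′ d c} → x ≤ x′ → SegmentsFrom x′ d c → SegmentsFrom x d c
    weaken x≤x′ (segs , isSeg , linked , x′≤ , eq) =
      segs , isSeg , linked , All.map (≤-trans x≤x′) x′≤ , eq

    rescale : ∀ {x d c} z → SegmentsFrom x d c → SegmentsFrom x (d * z) (c * z)
    rescale {_} {d} {c} z (segs , isSeg , linked , x≤ , eq) = segs , isSeg , linked , x≤ ,
      trans (sym (*-assoc (foldr _*_ 1 (map proj₂ segs)) c z))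
        (trans (cong (_* z) eq) (*-assoc (foldr _*_ 1 (map proj₁ segs)) d z))

    cancel : ∀ {x d c} z → NonZero z → SegmentsFrom x (d * z) (c * z) → SegmentsFrom x d c
    cancel {_} {d} {c} z z≢0 (segs , isSeg , linked , x≤ , eq) = segs , isSeg , linked , x≤ ,
      *-cancelʳ-≡ _ _ z ⦃ z≢0 ⦄
        (trans (*-assoc (foldr _*_ 1 (map proj₂ segs)) c z)
          (trans eq (sym (*-assoc (foldr _*_ 1 (map proj₁ segs)) d z))))

    prepend : ∀ {x z d c} → Segment S v x z → SegmentsFrom z d c → SegmentsFrom x (d * z) (c * x)
    prepend {x} {z} {d} {c} seg@(x<z , _) (segs , isSeg , linked , z≤ , eq) =
      (x , z) ∷ segs , seg ∷ isSeg , link z≤ linked , ≤-refl ∷ All.map (≤-trans (<⇒≤ x<z)) z≤ ,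
      trans (reorder z num c x) (trans (cong (x * z *_) eq) (reorder′ x z den d))
      where
      num den : ℕ
      num = foldr _*_ 1 (map proj₂ segs)
      den = foldr _*_ 1 (map proj₁ segs)

      reorder : ∀ z num c x → z * num * (c * x) ≡ x * z * (num * c)
      reorder = solve-∀

      reorder′ : ∀ x z den d → x * z * (den * d) ≡ x * den * (d * z)
      reorder′ = solve-∀

      link : ∀ {segs} → All (λ s → z ≤ proj₁ s) segs → Linked (λ s t → proj₁ s < proj₁ t) segs →
             Linked (λ s t → proj₁ s < proj₁ t) ((x , z) ∷ segs)
      link [] [] = [-]
      link (z≤ ∷ _) linked@([-]) = <-≤-trans x<z z≤ ∷ linked
      link (z≤ ∷ _) linked@(_ ∷ _) = <-≤-trans x<z z≤ ∷ linked

    -- The least log-integral position beyond x closes a segment. Repeating this up to x′ yields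
    -- relative degrees that telescope to x′/x.
    subdivide : ∀ {x x′ d c} → x ≤ x′ → LogIntegralAt S v x → LogIntegralAt S v x′ →
                SegmentsFrom x′ d c → SegmentsFrom x (d * x′) (c * x)
    subdivide {x} {x′} {d} {c} x≤x′ lx lx′ rest = go x x≤x′ lx (<-wellFounded (x′ ∸ x))
      where
      go : ∀ x → x ≤ x′ → LogIntegralAt S v x → Acc _<_ (x′ ∸ x) → SegmentsFrom x (d * x′) (c * x)
      go x x≤x′ lx (acc rec) with m≤n⇒m<n∨m≡n x≤x′
      ... | inj₂ refl = rescale x rest
      ... | inj₁ x<x′ with minimum (λ z → L? z ×-dec (x <? z)) _≤_ ≤-total (λ _ _ _ → ≤-trans) (suc x′)
      ...   | inj₁ none = ⊥-elim (none x′ ≤-refl (lx′ , x<x′))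
      ...   | inj₂ (z , (lz , x<z) , z≤) =
        cancel z (>-nonZero (≤-<-trans z≤n x<z))
          (subst (SegmentsFrom x (d * x′ * z)) (reorder c z x)
            (prepend (x<z , lx , lz , gap) (go z z≤x′ lz (rec (∸-monoʳ-< x<z z≤x′)))))
        where
        z≤x′ : z ≤ x′
        z≤x′ = z≤ x′ ≤-refl (lx′ , x<x′)

        gap : ∀ y → x < y → y < z → ¬ LogIntegralAt S v y
        gap y x<y y<z ly = <⇒≱ y<z (z≤ y (s≤s (<⇒≤ (<-≤-trans y<z z≤x′))) (ly , x<y))

        reorder : ∀ c z x → c * z * x ≡ c * x * z
        reorder = solve-∀

  Proper : (ℕ × ℕ) × (ℕ × ℕ) → Set
  Proper (P , Q) = NonZero (proj₁ P) × proj₁ P < proj₁ Q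

  -- Hence a product of two extremal indices comes from no other pair.
  *-rigid-≥ : ∀ {i j i′ j′} → NonZero j → i ≤ i′ → j ≤ j′ → i′ * j′ ≡ i * j → i′ ≡ i
  *-rigid-≥ {i} {j} {i′} {j′} j≢0 i≤i′ j≤j′ eq with m≤n⇒m<n∨m≡n i≤i′
  ... | inj₂ i≡i′ = sym i≡i′
  ... | inj₁ i<i′ = ⊥-elim (<⇒≱ (*-monoˡ-< j ⦃ j≢0 ⦄ i<i′)
                      (≤-trans (*-monoʳ-≤ i′ j≤j′) (≤-reflexive eq)))

  -- Minkowski sum of the polygons of two factors.

  module Factors
    (G H S : ℕ → Set ℓ) (G? : ∀ i → Dec (G i)) (H? : ∀ i → Dec (H i))
    (N : ℕ) (G<N : ∀ i → G i → i < N) (H<N : ∀ i → H i → i < N)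
    (G≢0 : ∀ {i} → G i → NonZero i) (H≢0 : ∀ {i} → H i → NonZero i)
    (g h v : ℕ → ℕ) (δ : ℕ)
    -- The two halves of the ultrametric law, corrected by the shift `δ`: a sum is at least as
    -- divisible as its least divisible term, and a single least divisible term fixes its valuation.
    (cover : ∀ i → S i → ∃₂ λ j k → G j × H k × j * k ≡ i × g j + h k ≤ v i + δ)
    (unique : ∀ j k → G j → H k →
      (∀ j′ k′ → G j′ → H k′ → j′ * k′ ≡ j * k → j′ ≡ j ⊎ g j + h k < g j′ + h k′) →
      S (j * k) × v (j * k) + δ ≡ g j + h k)
    where

    -- For x in `T`, the line of direction `σ` through the point over x supports the polygon of `T`.
    Minimal : (ℕ → Set ℓ) → (ℕ → ℕ) → (ℕ × ℕ) × (ℕ × ℕ) → ℕ → Set ℓ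
    Minimal T t σ x = ∀ z → T z → ((z , t z) , (x , t x)) ≼ σ

    module OnLine
      (P Q : ℕ × ℕ) (P≢0 : NonZero (proj₁ P)) (P<Q : proj₁ P < proj₁ Q)
      (x y : ℕ) (Gx : G x) (Hy : H y) (minx : Minimal G g (P , Q) x) (miny : Minimal H h (P , Q) y) where

      Q≢0 : NonZero (proj₁ Q)
      Q≢0 = nonZero-≤ P≢0 (<⇒≤ P<Q)

      -- As x and y are minimal, these are the support points lying on the supporting lines.
      MG MH : ℕ → Set ℓ
      MG z = G z × ((x , g x) , (z , g z)) ≼ (P , Q)
      MH z = H z × ((y , h y) , (z , h z)) ≼ (P , Q)

      MG? : ∀ z → Dec (MG z)
      MG? z = G? z ×-dec (_ ≼? _)

      MH? : ∀ z → Dec (MH z)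
      MH? z = H? z ×-dec (_ ≼? _)

      -- A competing pair with the same product and no greater valuation sum is no higher. Since
      -- neither component can drop below its supporting line, both lie on those lines, where `only`
      -- applies; thus `unique` determines the valuation.
      vertex : ∀ {i j} → MG i → MH j → (∀ i′ j′ → MG i′ → MH j′ → i′ * j′ ≡ i * j → i′ ≡ i) →
               S (i * j) × v (i * j) + δ ≡ g i + h j
      vertex {i} {j} (Gi , x≼i) (Hj , y≼j) only = unique i j Gi Hj sole
        where
        sole : ∀ i′ j′ → G i′ → H j′ → i′ * j′ ≡ i * j → i′ ≡ i ⊎ g i + h j < g i′ + h j′
        sole i′ j′ Gi′ Hj′ eq with ≤-<-connex (g i′ + h j′) (g i + h j)
        ... | inj₂ lt = inj₂ lt
        ... | inj₁ le = inj₁ (only i′ j′ (Gi′ , chainG) (Hj′ , chainH) eq)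
          where
          below : ((i * j , g i + h j) , (i′ * j′ , g i′ + h j′)) ≼ (P , Q)
          below = subst (λ n → ((i * j , g i + h j) , (n , g i′ + h j′)) ≼ (P , Q)) (sym eq)
                    (vertical (<⇒≤ P<Q) le)

          i≼i′ : ((i , g i) , (i′ , g i′)) ≼ (P , Q)
          i≼i′ = ≼-∙-cancel P≢0 Q≢0 (H≢0 Hj) (H≢0 Hj′) below
                   (≼-chain P≢0 Q≢0 (H≢0 Hy) (miny j′ Hj′) y≼j)

          chainG : ((x , g x) , (i′ , g i′)) ≼ (P , Q)
          chainG = ≼-chain P≢0 Q≢0 (G≢0 Gi) x≼i i≼i′

          j≼j′ : ((j , h j) , (j′ , h j′)) ≼ (P , Q)
          j≼j′ = ≼-∙-cancel P≢0 Q≢0 (G≢0 Gi) (G≢0 Gi′)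
                   (subst₂ (λ R S → (R , S) ≼ (P , Q))
                     (cong₂ _,_ (*-comm i j) (+-comm (g i) (h j)))
                     (cong₂ _,_ (*-comm i′ j′) (+-comm (g i′) (h j′))) below)
                   (≼-chain P≢0 Q≢0 (G≢0 Gx) (minx i′ Gi′) x≼i)

          chainH : ((y , h y) , (j′ , h j′)) ≼ (P , Q)
          chainH = ≼-chain P≢0 Q≢0 (H≢0 Hj) y≼j j≼j′

      MG<N : ∀ z → MG z → z < N
      MG<N z (Gz , _) = G<N z Gz

      MH<N : ∀ z → MH z → z < N
      MH<N z (Hz , _) = H<N z Hz

      X w : ℕ
      X = x * y
      w = g x + h y

      above : ∀ z → S z → ((z , v z + δ) , (X , w)) ≼ (P , Q)
      above z Sz with cover z Sz
      ... | j , k , Gj , Hk , refl , le =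
        ≼-chain P≢0 Q≢0 (m*n≢0 j k ⦃ G≢0 Gj ⦄ ⦃ H≢0 Hk ⦄) (vertical (<⇒≤ P<Q) le)
          (≼-∙ (minx j Gj) (miny k Hk))

      Vertex : ℕ → Set ℓ
      Vertex z = S z × ((X , w) , (z , v z + δ)) ≼ (P , Q)

      X≢0 : NonZero X
      X≢0 = m*n≢0 x y ⦃ G≢0 Gx ⦄ ⦃ H≢0 Hy ⦄

      mkVertex : ∀ {i j} → MG i → MH j → S (i * j) × v (i * j) + δ ≡ g i + h j → Vertex (i * j)
      mkVertex {i} {j} (_ , x≼i) (_ , y≼j) (Sij , eq) =
        Sij , subst (λ n → ((X , w) , (i * j , n)) ≼ (P , Q)) (sym eq) (≼-∙ x≼i y≼j)

      -- The least indices on the two supporting lines multiply to the left end of the face of the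
      -- product, and no other pair on those lines has this product.
      leftVertex : ∃ λ z → z ≤ X × Vertex z
      leftVertex with least MG? N MG<N x (Gx , ≼-refl) | least MH? N MH<N y (Hy , ≼-refl)
      ... | i , mi , i≤ | j , mj , j≤ = i * j , *-mono-≤ (i≤ x (Gx , ≼-refl)) (j≤ y (Hy , ≼-refl)) ,
        mkVertex mi mj (vertex mi mj λ i′ j′ mi′ mj′ → *-rigid-≥ (H≢0 (proj₁ mj)) (i≤ i′ mi′) (j≤ j′ mj′))

      rightVertex : ∃ λ z → X ≤ z × Vertex z
      rightVertex with greatest MG? N MG<N x (Gx , ≼-refl) | greatest MH? N MH<N y (Hy , ≼-refl)
      ... | i , mi , i≥ | j , mj , j≥ = i * j , *-mono-≤ (i≥ x (Gx , ≼-refl)) (j≥ y (Hy , ≼-refl)) ,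
        mkVertex mi mj (vertex mi mj λ i′ j′ mi′ mj′ eq →
          sym (*-rigid-≥ (H≢0 (proj₁ mj′)) (i≥ i′ mi′) (j≥ j′ mj′) (sym eq)))

      S≢0 : ∀ {z} → S z → NonZero z
      S≢0 {z} Sz with cover z Sz
      ... | j , k , Gj , Hk , refl , _ = m*n≢0 j k ⦃ G≢0 Gj ⦄ ⦃ H≢0 Hk ⦄

      -- Going from (X, w) along the line PQ towards one of the two vertices does not raise the height.
      δ≤ : (∃ λ z → z ≤ X × Vertex z) → (∃ λ z → X ≤ z × Vertex z) →
           proj₂ P ≤ proj₂ Q ⊎ proj₂ Q ≤ proj₂ P → δ ≤ w
      δ≤ (z , z≤X , Sz , X≼z) _ (inj₁ P≤Q) =
        ≤-trans (m≤n+m δ (v z)) (vertical-cancel X≢0 P≢0 P<Q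
          (≼-chain P≢0 Q≢0 (S≢0 Sz) X≼z (horizontal-↑ z≤X P≤Q)))
      δ≤ _ (z , X≤z , Sz , X≼z) (inj₂ Q≤P) =
        ≤-trans (m≤n+m δ (v z)) (vertical-cancel X≢0 P≢0 P<Q
          (≼-chain P≢0 Q≢0 (S≢0 Sz) X≼z (horizontal-↓ X≤z Q≤P)))

      Y : ℕ
      Y = w ∸ δ

      module _ (left : ∃ λ z → z ≤ X × Vertex z) (right : ∃ λ z → X ≤ z × Vertex z) where

        Y+δ≡w : Y + δ ≡ w
        Y+δ≡w = m∸n+n≡m (δ≤ left right (≤-total (proj₂ P) (proj₂ Q)))

        above′ : ∀ z → S z → ((z , v z) , (X , Y)) ≼ (P , Q)
        above′ z Sz = ≼-shift P≢0 Q≢0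
          (subst (λ n → ((z , v z + δ) , (X , n)) ≼ (P , Q)) (sym Y+δ≡w) (above z Sz))

        below : ∀ {z} → Vertex z → ((X , Y) , (z , v z)) ≼ (P , Q)
        below {z} (_ , X≼z) = ≼-shift P≢0 Q≢0
          (subst (λ n → ((X , n) , (z , v z + δ)) ≼ (P , Q)) (sym Y+δ≡w) X≼z)

        Xʸ≢0 : NonZero (X ^ Y)
        Xʸ≢0 = m^n≢0 X Y ⦃ X≢0 ⦄

        reorder : ∀ p q r s → p * q * (r * s) ≡ s * r * p * q
        reorder = solve-∀

        reorder′ : ∀ p q r s → p * q * (r * s) ≡ p * s * q * r
        reorder′ = solve-∀

        -- All points of the product lie above the line of direction PQ through (X, Y). So the slope
        -- from i to X is at most that of PQ, which is at most the slope from X to j.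
        chord : ∀ {i j} → S i → S j → i < j → i ≤ X → X ≤ j → ChordGE S v i j X Y
        chord {i} {j} Si Sj i<j i≤X X≤j =
          -- The two chords share the point (X, Y), which leaves the common factor `X ^ Y`.
          *-cancelʳ-≤ _ _ (X ^ Y) ⦃ Xʸ≢0 ⦄
            (subst₂ _≤_ (reorder (j ^ Y) (X ^ Y) (X ^ v i) (i ^ v j)) (reorder′ (j ^ v i) (i ^ Y) (X ^ Y) (X ^ v j))
              (un≼ (≼-trans (S≢0 Si) P≢0 X≢0 i≤X P<Q X≤j (above′ i Si) (≼-unflip (above′ j Sj)))))

        chord′ : ∀ {i j} → Vertex i → Vertex j → i < j → i ≤ X → X ≤ j → ChordEq S v i j X Y
        chord′ {i} {j} Vi Vj i<j i≤X X≤j = ≤-antisym (chord (proj₁ Vi) (proj₁ Vj) i<j i≤X X≤j)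
          (*-cancelʳ-≤ _ _ (X ^ Y) ⦃ Xʸ≢0 ⦄
            (subst₂ _≤_ (reorder′ (j ^ v i) (i ^ Y) (X ^ Y) (X ^ v j)) (reorder (j ^ Y) (X ^ Y) (X ^ v i) (i ^ v j))
              (un≼ (≼-flip (≼-trans X≢0 P≢0 (S≢0 (proj₁ Vi)) X≤j P<Q i≤X (below Vj) (≼-unflip (below Vi)))))))

        supported : S X → Y ≤ v X
        supported SX = vertical-cancel X≢0 P≢0 P<Q (above′ X SX)

        onHull : (S X × v X ≡ Y) ⊎
          (∃[ i ] ∃[ j ] (S i × S j × i < j × i ≤ X × X ≤ j × ChordEq S v i j X Y))
        onHull = attained left right
          where
          attained : (∃ λ z → z ≤ X × Vertex z) → (∃ λ z → X ≤ z × Vertex z) →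
            (S X × v X ≡ Y) ⊎ (∃[ i ] ∃[ j ] (S i × S j × i < j × i ≤ X × X ≤ j × ChordEq S v i j X Y))
          attained (i , i≤X , Vi) (j , X≤j , Vj) with m≤n⇒m<n∨m≡n (≤-trans i≤X X≤j)
          ... | inj₁ i<j = inj₂ (i , j , proj₁ Vi , proj₁ Vj , i<j , i≤X , X≤j , chord′ Vi Vj i<j i≤X X≤j)
          -- The two vertices coincide only at X, which is then itself a support point.
          ... | inj₂ refl with ≤-antisym i≤X X≤j
          ...   | refl = inj₁ (proj₁ Vi ,
                    ≤-antisym (vertical-cancel X≢0 P≢0 P<Q (below Vi)) (supported (proj₁ Vi)))

      logIntegral : LogIntegralAt S v (x * y)
      logIntegral = Y , onHull leftVertex rightVertex , supported leftVertex rightVertex ,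
        λ i j Si Sj i<j i≤X X≤j → chord leftVertex rightVertex Si Sj i<j i≤X X≤j

    -- The simultaneous walk along both polygons.

    module Walk (L? : ∀ x → Dec (LogIntegralAt S v x)) (n : ℕ) (Gn : G n) (≤n : ∀ z → G z → z ≤ n) where

      open Segments S v L?

      pG pH : ℕ → ℕ × ℕ
      pG z = z , g z
      pH z = z , h z

      RightChord : ℕ → ℕ → (ℕ × ℕ) × (ℕ × ℕ) → Set ℓ
      RightChord x y σ = (∃ λ z → G z × x < z × (pG x , pG z) ≼ σ) ⊎ (∃ λ z → H z × y < z × (pH y , pH z) ≼ σ)

      -- No chord ending at the current pair of vertices is steeper than a chord leaving it.
      Convex : ℕ → ℕ → Set ℓ
      Convex x y = ∀ {σ} → Proper σ → RightChord x y σ →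
        (∀ z → G z → z < x → (pG z , pG x) ≼ σ) × (∀ z → H z → z < y → (pH z , pH y) ≼ σ)

      minimal : ∀ {T : ℕ → Set ℓ} {t x σ} → (∀ z → T z → z < x → ((z , t z) , (x , t x)) ≼ σ) →
        (∀ z → T z → x < z → σ ≼ ((x , t x) , (z , t z))) → Minimal T t σ x
      minimal {x = x} left right z Tz with <-cmp z x
      ... | tri< z<x _ _ = left z Tz z<x
      ... | tri≈ _ refl _ = ≼-refl
      ... | tri> _ _ x<z = ≼-flip (right z Tz x<z)

      ≼-refl-slope : ∀ σ → σ ≼ σ
      ≼-refl-slope σ with ≼-connex σ σ
      ... | inj₁ h = h
      ... | inj₂ h = h

      -- Chords ending at a point of support have slope at most that of `σ`, and chords leaving it
      -- at least that; this restores the invariant after a step along `σ`.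
      minimal⇒convex : ∀ {σ x y} → Proper σ → G x → H y → Minimal G g σ x → Minimal H h σ y → Convex x y
      minimal⇒convex {σ} {x} {y} (P≢0 , P<Q) Gx Hy minx miny {τ} (R≢0 , R<S) right =
        (λ z Gz z<x → ≼-trans (G≢0 Gz) P≢0 R≢0 (<⇒≤ z<x) P<Q (<⇒≤ R<S) (minx z Gz) (σ≼τ right)) ,
        (λ z Hz z<y → ≼-trans (H≢0 Hz) P≢0 R≢0 (<⇒≤ z<y) P<Q (<⇒≤ R<S) (miny z Hz) (σ≼τ right))
        where
        σ≼τ : RightChord x y τ → σ ≼ τ
        σ≼τ (inj₁ (z , Gz , x<z , h)) =
          ≼-trans P≢0 (G≢0 Gx) R≢0 (<⇒≤ P<Q) x<z (<⇒≤ R<S) (≼-unflip (minx z Gz)) h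
        σ≼τ (inj₂ (z , Hz , y<z , h)) =
          ≼-trans P≢0 (H≢0 Hy) R≢0 (<⇒≤ P<Q) y<z (<⇒≤ R<S) (≼-unflip (miny z Hz)) h

      advance : ∀ {T : ℕ → Set ℓ} {t x x′ σ} → Proper σ → (∀ {z} → T z → NonZero z) → T x →
        ((x , t x) , (x′ , t x′)) ≼ σ → Minimal T t σ x → Minimal T t σ x′
      advance (P≢0 , P<Q) T≢0 Tx h minx z Tz =
        ≼-chain P≢0 (nonZero-≤ P≢0 (<⇒≤ P<Q)) (T≢0 Tx) (minx z Tz) h

      module Step {σ x y} (proper : Proper σ) (Gx : G x) (Hy : H y) (convex : Convex x y)
        (right : RightChord x y σ) (rightG : ∀ z → G z → x < z → σ ≼ (pG x , pG z))
        (rightH : ∀ z → H z → y < z → σ ≼ (pH y , pH z)) where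

        minx : Minimal G g σ x
        minx = minimal (proj₁ (convex proper right)) rightG

        miny : Minimal H h σ y
        miny = minimal (proj₂ (convex proper right)) rightH

      -- The index x′ is some point of the edge that leaves x, not necessarily its far end; an edge
      -- may be crossed in several steps.
      Next : (ℕ → Set ℓ) → (ℕ → ℕ) → ℕ → ℕ → Set ℓ
      Next T t x x′ = (T x′ × x < x′) × (∀ z → T z → x < z → ((x , t x) , (x′ , t x′)) ≼ ((x , t x) , (z , t z)))

      next : ∀ {T : ℕ → Set ℓ} {t} → (∀ i → Dec (T i)) → (∀ i → T i → i < N) → ∀ x → NonZero x →
             (∀ z → T z → ¬ x < z) ⊎ ∃ (Next T t x)
      next {T} {t} T? T<N x x≢0 = result (minimum (λ z → T? z ×-dec (x <? z))
        (λ i j → ((x , t x) , (i , t i)) ≼ ((x , t x) , (j , t j)))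
        (λ i j → ≼-connex ((x , t x) , (i , t i)) ((x , t x) , (j , t j)))
        (λ (_ , x<i) (_ , x<j) (_ , x<k) → ≼-trans x≢0 x≢0 x≢0 (<⇒≤ x<i) x<j (<⇒≤ x<k)) N)
        where
        result : _ → (∀ z → T z → ¬ x < z) ⊎ ∃ (Next T t x)
        result (inj₁ none) = inj₁ λ z Tz x<z → none z (T<N z Tz) (Tz , x<z)
        result (inj₂ (x′ , c , least)) = inj₂ (x′ , c , λ z Tz x<z → least z (T<N z Tz) (Tz , x<z))

      -- Only steps of g contribute segments, with ratio x′/x after the common y cancels; steps of h
      -- merely move the starting point to the right. The contributions telescope to n/x.
      walk : ∀ k x y → (N ∸ x) + (N ∸ y) < k → G x → H y → Convex x y → SegmentsFrom (x * y) n x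
      walk (suc k) x y (s≤s fuel) Gx Hy convex =
        choose (next G? G<N x (G≢0 Gx)) (next H? H<N y (H≢0 Hy))
        where
        stepG : ∀ {x′} → Next G g x x′ → (∀ z → H z → y < z → (pG x , pG x′) ≼ (pH y , pH z)) →
                SegmentsFrom (x * y) n x
        stepG {x′} ((Gx′ , x<x′) , rightG) rightH =
          -- The stretch from xy to x′y followed by the remaining ratio n/x′ gives n/x, both terms
          -- multiplied by x′y.
          cancel (x′ * y) (m*n≢0 x′ y ⦃ G≢0 Gx′ ⦄ ⦃ H≢0 Hy ⦄)
            (subst (SegmentsFrom (x * y) (n * (x′ * y))) (reorder x′ x y)
              (subdivide (*-monoˡ-≤ y (<⇒≤ x<x′))
                (OnLine.logIntegral (pG x) (pG x′) (G≢0 Gx) x<x′ x y Gx Hy minx miny)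
                (OnLine.logIntegral (pG x) (pG x′) (G≢0 Gx) x<x′ x′ y Gx′ Hy minx′ miny)
                (walk k x′ y (≤-trans (+-monoˡ-< (N ∸ y) (∸-monoʳ-< x<x′ (<⇒≤ (G<N x′ Gx′)))) fuel) Gx′ Hy
                  (minimal⇒convex proper Gx′ Hy minx′ miny))))
          where
          proper : Proper (pG x , pG x′)
          proper = G≢0 Gx , x<x′

          open Step proper Gx Hy convex (inj₁ (x′ , Gx′ , x<x′ , ≼-refl-slope (pG x , pG x′))) rightG rightH

          minx′ : Minimal G g (pG x , pG x′) x′
          minx′ = advance {G} {g} proper G≢0 Gx (≼-refl-slope (pG x , pG x′)) minx

          reorder : ∀ x′ x y → x′ * (x * y) ≡ x * (x′ * y)
          reorder = solve-∀

        stepH : ∀ {y′} → Next H h y y′ → (∀ z → G z → x < z → (pH y , pH y′) ≼ (pG x , pG z)) →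
                SegmentsFrom (x * y) n x
        stepH {y′} ((Hy′ , y<y′) , rightH) rightG =
          weaken (*-monoʳ-≤ x (<⇒≤ y<y′))
            (walk k x y′ (≤-trans (+-monoʳ-< (N ∸ x) (∸-monoʳ-< y<y′ (<⇒≤ (H<N y′ Hy′)))) fuel) Gx Hy′
              (minimal⇒convex proper Gx Hy′ minx
                (advance {H} {h} proper H≢0 Hy (≼-refl-slope (pH y , pH y′)) miny)))
          where
          proper : Proper (pH y , pH y′)
          proper = H≢0 Hy , y<y′

          open Step proper Gx Hy convex (inj₂ (y′ , Hy′ , y<y′ , ≼-refl-slope (pH y , pH y′))) rightG rightH

        choose : (∀ z → G z → ¬ x < z) ⊎ ∃ (Next G g x) → (∀ z → H z → ¬ y < z) ⊎ ∃ (Next H h y) →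
                 SegmentsFrom (x * y) n x
        choose (inj₁ none) _ = [] , [] , [] , [] , cong (1 *_) (≤-antisym (≤n x Gx) (≮⇒≥ (none n Gn)))
        choose (inj₂ (x′ , nx)) (inj₁ none) = stepG nx λ z Hz y<z → ⊥-elim (none z Hz y<z)
        -- The lesser of the two next slopes is taken; by transitivity every chord leaving the other
        -- vertex has at least this slope.
        choose (inj₂ (x′ , nx@((Gx′ , x<x′) , rightG))) (inj₂ (y′ , ny@((Hy′ , y<y′) , rightH)))
          with ≼-connex (pG x , pG x′) (pH y , pH y′)
        ... | inj₁ le = stepG nx λ z Hz y<z →
                ≼-trans (G≢0 Gx) (H≢0 Hy) (H≢0 Hy) (<⇒≤ x<x′) y<y′ (<⇒≤ y<z) le (rightH z Hz y<z)
        ... | inj₂ ge = stepH ny λ z Gz x<z →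
                ≼-trans (H≢0 Hy) (G≢0 Gx) (G≢0 Gx) (<⇒≤ y<y′) x<x′ (<⇒≤ x<z) ge (rightG z Gz x<z)

      inProducts : ∀ m → G m → (∀ z → G z → m ≤ z) → ∀ m′ → H m′ → (∀ z → H z → m′ ≤ z) → InProducts S v n m
      inProducts m Gm m≤ m′ Hm′ m′≤ =
        -- At the first indices no chord arrives from the left, so the convexity invariant is
        -- vacuous.
        forget (walk _ m m′ ≤-refl Gm Hm′ λ _ _ →
          (λ z Gz z<m → ⊥-elim (<⇒≱ z<m (m≤ z Gz))) , (λ z Hz z<m′ → ⊥-elim (<⇒≱ z<m′ (m′≤ z Hz))))
        where
        forget : ∀ {x} → SegmentsFrom x n m → InProducts S v n m
        forget (segs , isSeg , linked , _ , eq) =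
          foldr _*_ 1 (map proj₂ segs) , foldr _*_ 1 (map proj₁ segs) , (segs , isSeg , linked , refl , refl) , eq

open NewtonPolygon using (least; greatest; *-rigid-≥; module Factors)

-- Finitely many uses of excluded middle under a double negation.

¬¬-dec : ∀ {A : Set ℓ} → ¬ ¬ Dec A
¬¬-dec k = k (no λ a → k (yes a))

¬¬-pull-< : ∀ {P : ℕ → Set ℓ} N → (∀ i → ¬ ¬ P i) → ¬ ¬ (∀ i → i < N → P i)
¬¬-pull-< zero _ k = k λ _ ()
¬¬-pull-< {P = P} (suc N) ¬¬P k = ¬¬P N λ pN → ¬¬-pull-< N ¬¬P λ ps → k (extend pN ps)
  where
  extend : P N → (∀ i → i < N → P i) → ∀ i → i < suc N → P i
  extend pN ps i i≤N with ℕ.m<1+n⇒m<n∨m≡n i≤N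
  ... | inj₁ i<N = ps i i<N
  ... | inj₂ ≡.refl = pN

-- From N on the property is given outright, so only finitely many double negations pass the
-- quantifier.
¬¬-pull : ∀ {P : ℕ → Set ℓ} N → (∀ i → N ≤ i → P i) → (∀ i → ¬ ¬ P i) → ¬ ¬ (∀ i → P i)
¬¬-pull {P = P} N tail ¬¬P k = ¬¬-pull-< N ¬¬P λ ps → k (extend ps)
  where
  extend : (∀ i → i < N → P i) → ∀ i → P i
  extend ps i with ℕ.<-≤-connex i N
  ... | inj₁ i<N = ps i i<N
  ... | inj₂ N≤i = tail i N≤i

¬¬-pull-Fin : ∀ {n} {P : Fin n → Set ℓ} → (∀ i → ¬ ¬ P i) → ¬ ¬ (∀ i → P i)
¬¬-pull-Fin {n = zero} _ k = k λ ()
¬¬-pull-Fin {n = suc n} ¬¬P k = ¬¬P zero λ p₀ → ¬¬-pull-Fin (λ i → ¬¬P (suc i)) λ ps →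
  k λ { zero → p₀ ; (suc i) → ps i }

-- Supports, factorisations and extreme indices.

record Support (T : ℕ → Set ℓ) : Set ℓ where
  field
    dec : ∀ i → Dec (T i)
    nonZero : ∀ {i} → T i → NonZero i
    first last : ℕ
    ∈-first : T first
    ∈-last : T last
    first≤ : ∀ i → T i → first ≤ i
    ≤last : ∀ i → T i → i ≤ last

support : ∀ {T : ℕ → Set ℓ} → (∀ i → Dec (T i)) → (∀ {i} → T i → NonZero i) →
          ∀ N → (∀ i → T i → i < N) → ∃ T → Support T
support T? T≢0 N T<N (i , Tᵢ) = record
  { dec = T? ; nonZero = T≢0 ; first = proj₁ lo ; last = proj₁ hi
  ; ∈-first = proj₁ (proj₂ lo) ; ∈-last = proj₁ (proj₂ hi)
  ; first≤ = proj₂ (proj₂ lo) ; ≤last = proj₂ (proj₂ hi) }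
  where
  lo = least T? N T<N i Tᵢ
  hi = greatest T? N T<N i Tᵢ

-- What the Newton polygon argument retains of an identity Δ f = g h of Dirichlet polynomials with supports
-- S, G, H and valuations v, g, h, where Δ is a constant of valuation δ.
record Factorisation (G H S : ℕ → Set ℓ) (g h v : ℕ → ℕ) (δ : ℕ) : Set ℓ where
  field
    cover : ∀ i → S i → ∃₂ λ j k → G j × H k × j ℕ.* k ≡ i × g j ℕ.+ h k ≤ v i ℕ.+ δ
    unique : ∀ j k → G j → H k →
      (∀ j′ k′ → G j′ → H k′ → j′ ℕ.* k′ ≡ j ℕ.* k → j′ ≡ j ⊎ g j ℕ.+ h k < g j′ ℕ.+ h k′) →
      S (j ℕ.* k) × v (j ℕ.* k) ℕ.+ δ ≡ g j ℕ.+ h k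

swap : ∀ {G H S : ℕ → Set ℓ} {g h v δ} → (∀ {i} → H i → NonZero i) →
       Factorisation G H S g h v δ → Factorisation H G S h g v δ
swap {G = G} {H} {S} {g} {h} {v} {δ} H≢0 F = record { cover = cover′ ; unique = unique′ }
  where
  open Factorisation F

  cover′ : ∀ i → S i → ∃₂ λ j k → H j × G k × j ℕ.* k ≡ i × h j ℕ.+ g k ≤ v i ℕ.+ δ
  cover′ i Sᵢ with cover i Sᵢ
  ... | j , k , Gj , Hk , eq , le =
    k , j , Hk , Gj , ≡.trans (ℕ.*-comm k j) eq , ≡.subst (_≤ v i ℕ.+ δ) (ℕ.+-comm (g j) (h k)) le

  unique′ : ∀ j k → H j → G k →
    (∀ j′ k′ → H j′ → G k′ → j′ ℕ.* k′ ≡ j ℕ.* k → j′ ≡ j ⊎ h j ℕ.+ g k < h j′ ℕ.+ g k′) →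
    S (j ℕ.* k) × v (j ℕ.* k) ℕ.+ δ ≡ h j ℕ.+ g k
  unique′ j k Hj Gk sole = ≡.subst₂ (λ i e → S i × v i ℕ.+ δ ≡ e) (ℕ.*-comm k j) (ℕ.+-comm (g k) (h j))
    (unique k j Gk Hj λ k′ j′ Gk′ Hj′ eq → flip-case k′ j′ eq
      (sole j′ k′ Hj′ Gk′ (≡.trans (ℕ.*-comm j′ k′) (≡.trans eq (ℕ.*-comm k j)))))
    where
    flip-case : ∀ k′ j′ → k′ ℕ.* j′ ≡ k ℕ.* j → j′ ≡ j ⊎ h j ℕ.+ g k < h j′ ℕ.+ g k′ →
                k′ ≡ k ⊎ g k ℕ.+ h j < g k′ ℕ.+ h j′
    -- Equality of one index of the pair passes to the other by cancelling in the equation of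
    -- products.
    flip-case k′ j′ eq (inj₁ ≡.refl) = inj₁ (ℕ.*-cancelʳ-≡ k′ k j ⦃ H≢0 Hj ⦄ eq)
    flip-case k′ j′ eq (inj₂ lt) = inj₂ (≡.subst₂ _<_ (ℕ.+-comm (h j) (g k)) (ℕ.+-comm (h j′) (g k′)) lt)

module _ {G H S : ℕ → Set ℓ} {g h v : ℕ → ℕ} {δ : ℕ} (sG : Support G) (sH : Support H)
  (F : Factorisation G H S g h v δ) where

  open Factorisation F
  private
    module G = Support sG
    module H = Support sH

  factor-inProducts : (∀ x → Dec (LogIntegralAt S v x)) → InProducts S v G.last G.first
  factor-inProducts L? = Factors.Walk.inProducts G H S G.dec H.dec (suc (G.last ℕ.+ H.last))
    (λ i Gᵢ → s≤s (ℕ.≤-trans (G.≤last i Gᵢ) (ℕ.m≤m+n G.last H.last)))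
    (λ i Hᵢ → s≤s (ℕ.≤-trans (H.≤last i Hᵢ) (ℕ.m≤n+m H.last G.last)))
    G.nonZero H.nonZero g h v δ cover unique L?
    G.last G.∈-last G.≤last G.first G.∈-first G.first≤ H.first H.∈-first H.first≤

  module _ {m n : ℕ} (Sm : S m) (Sn : S n) (m≤ : ∀ i → S i → m ≤ i) (≤n : ∀ i → S i → i ≤ n) where

    -- No other pair of indices has the product of the first ones, so `unique` puts it in the
    -- support; by `cover` no smaller index occurs.
    m≡ : m ≡ G.first ℕ.* H.first
    m≡ = ℕ.≤-antisym (m≤ _ (proj₁ (unique G.first H.first G.∈-first H.∈-first λ j k Gj Hk eq →
           inj₁ (*-rigid-≥ (H.nonZero H.∈-first) (G.first≤ j Gj) (H.first≤ k Hk) eq)))) lower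
      where
      lower : G.first ℕ.* H.first ≤ m
      lower with cover m Sm
      ... | j , k , Gj , Hk , ≡.refl , _ = ℕ.*-mono-≤ (G.first≤ j Gj) (H.first≤ k Hk)

    n≡ : n ≡ G.last ℕ.* H.last
    n≡ = ℕ.≤-antisym upper (≤n _ (proj₁ (unique G.last H.last G.∈-last H.∈-last λ j k Gj Hk eq →
           inj₁ (≡.sym (*-rigid-≥ (H.nonZero Hk) (G.≤last j Gj) (H.≤last k Hk) (≡.sym eq))))))
      where
      upper : n ≤ G.last ℕ.* H.last
      upper with cover n Sn
      ... | j , k , Gj , Hk , ≡.refl , _ = ℕ.*-mono-≤ (G.≤last j Gj) (H.≤last k Hk)

    -- If g were a monomial at index j, then j would divide every index of the product.
    first<last : (∀ d → (∀ i → S i → d ∣ i) → d ≡ 1) → (∃[ i ] (2 ≤ i × G i)) → G.first < G.last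
    first<last coprime (i , 2≤i , Gᵢ) with ℕ.m≤n⇒m<n∨m≡n (G.first≤ G.last G.∈-last)
    ... | inj₁ lt = lt
    ... | inj₂ first≡last =
      ⊥-elim (ℕ.<⇒≱ 2≤i (ℕ.≤-trans (G.≤last i Gᵢ) (ℕ.≤-reflexive (≡.trans (≡.sym first≡last) first≡1))))
      where
      first≡1 : G.first ≡ 1
      first≡1 = coprime G.first divides-all
        where
        divides-all : ∀ i → S i → G.first ∣ i
        divides-all i Sᵢ with cover i Sᵢ
        ... | j , k , Gj , _ , ≡.refl , _ = ≡.subst (λ l → l ∣ j ℕ.* k)
          (ℕ.≤-antisym (ℕ.≤-trans (G.≤last j Gj) (ℕ.≤-reflexive (≡.sym first≡last))) (G.first≤ j Gj)) (m∣m*n k)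

    -- Since n/m is the product of the ratios last/first of both factors, a ratio is at most
    -- sqrt(n/m) once it is at most the other one.
    inS1rd : G.first < G.last → G.last ℕ.* H.first ≤ H.last ℕ.* G.first → InS1rd m n G.last G.first
    inS1rd first<last le =
      ≡.subst (G.last ∣_) (≡.sym n≡) (m∣m*n H.last) , ≡.subst (G.first ∣_) (≡.sym m≡) (m∣m*n H.first) , first<last ,
      ≡.subst₂ (λ m n → G.last ℕ.* G.last ℕ.* m ≤ n ℕ.* G.first ℕ.* G.first) (≡.sym m≡) (≡.sym n≡)
        (≡.subst₂ _≤_ (reorder G.last G.first H.first) (reorder′ G.last G.first H.last)
          (ℕ.*-monoʳ-≤ (G.last ℕ.* G.first) le))
      where
      reorder : ∀ d c m → d ℕ.* c ℕ.* (d ℕ.* m) ≡ d ℕ.* d ℕ.* (c ℕ.* m)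
      reorder = solve-∀
      reorder′ : ∀ d c n → d ℕ.* c ℕ.* (n ℕ.* c) ≡ d ℕ.* n ℕ.* c ℕ.* c
      reorder′ = solve-∀

LogIntegral⇒≤ : ∀ {S : ℕ → Set ℓ} {v n} → (∀ i → S i → i ≤ n) → ∀ {x} → LogIntegralAt S v x → x ≤ n
LogIntegral⇒≤ ≤n {x} (_ , inj₁ (Sx , _) , _) = ≤n x Sx
LogIntegral⇒≤ ≤n (_ , inj₂ (_ , j , _ , Sj , _ , _ , x≤j , _) , _) = ℕ.≤-trans x≤j (≤n j Sj)

-- Divisibility and valuations at a prime element.

module RingTheory (R : CommutativeRing c ℓ) where

  open CommutativeRing R
  open import Algebra.Properties.Ring ring using (-‿distribʳ-*)
  open import Algebra.Properties.Group +-group using (x∙y⁻¹≈ε⇒x≈y)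
  open import Relation.Binary.Reasoning.Setoid setoid

  open import Algebra.Properties.CommutativeSemigroup *-commutativeSemigroup
    using (interchange; xy∙z≈xz∙y; x∙yz≈y∙xz)

  infix 4 _∣ᴿ_
  _∣ᴿ_ : Carrier → Carrier → Set _
  _∣ᴿ_ = DividesR R

  _^_ : Carrier → ℕ → Carrier
  _^_ = powR R

  ∣ᴿ-trans : ∀ {x y z} → x ∣ᴿ y → y ∣ᴿ z → x ∣ᴿ z
  ∣ᴿ-trans (q , y≈xq) (r , z≈yr) = q * r , trans z≈yr (trans (*-congʳ y≈xq) (*-assoc _ _ _))

  ∣ᴿ-respʳ : ∀ {x y z} → y ≈ z → x ∣ᴿ y → x ∣ᴿ z
  ∣ᴿ-respʳ y≈z (q , y≈xq) = q , trans (sym y≈z) y≈xq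

  ∣ᴿ-zero : ∀ {x} → x ∣ᴿ 0#
  ∣ᴿ-zero = 0# , sym (zeroʳ _)

  ∣ᴿ-* : ∀ {x y} z → x ∣ᴿ y → x ∣ᴿ y * z
  ∣ᴿ-* z x∣ᴿy = ∣ᴿ-trans x∣ᴿy (z , refl)

  ∣ᴿ-+ : ∀ {x y z} → x ∣ᴿ y → x ∣ᴿ z → x ∣ᴿ y + z
  ∣ᴿ-+ (q , y≈xq) (r , z≈xr) = q + r , trans (+-cong y≈xq z≈xr) (sym (distribˡ _ _ _))

  ∣ᴿ-+-cancel : ∀ {x y z} → x ∣ᴿ y + z → x ∣ᴿ z → x ∣ᴿ y
  ∣ᴿ-+-cancel {x} {y} {z} (q , eq) (r , z≈xr) = q + - r , (begin
    y                  ≈⟨ +-identityʳ y ⟨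
    y + 0#             ≈⟨ +-congˡ (-‿inverseʳ z) ⟨
    y + (z + - z)      ≈⟨ +-assoc y z (- z) ⟨
    (y + z) + - z      ≈⟨ +-cong eq (-‿cong z≈xr) ⟩
    x * q + - (x * r)  ≈⟨ +-congˡ (-‿distribʳ-* x r) ⟩
    x * q + x * - r    ≈⟨ distribˡ x q (- r) ⟨
    x * (q + - r)      ∎)

  ^-+ : ∀ x m n → x ^ (m ℕ.+ n) ≈ x ^ m * x ^ n
  ^-+ x zero n = sym (*-identityˡ _)
  ^-+ x (suc m) n = trans (*-congˡ (^-+ x m n)) (sym (*-assoc x (x ^ m) (x ^ n)))

  ^-∣ᴿ : ∀ x {m n} → m ℕ.≤ n → x ^ m ∣ᴿ x ^ n
  ^-∣ᴿ x {m} {n} m≤n = x ^ (n ℕ.∸ m) ,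
    trans (reflexive (≡.cong (x ^_) (≡.sym (ℕ.m+[n∸m]≡n m≤n)))) (^-+ x m (n ℕ.∸ m))

  module Domain (1≉0 : ¬ 1# ≈ 0#) (integral : ∀ x y → x * y ≈ 0# → x ≈ 0# ⊎ y ≈ 0#) where

    *-cancelˡ : ∀ {x y z} → ¬ x ≈ 0# → x * y ≈ x * z → y ≈ z
    *-cancelˡ {x} {y} {z} x≉0 xy≈xz with integral x (y + - z) (begin
      x * (y + - z)      ≈⟨ distribˡ x y (- z) ⟩
      x * y + x * - z    ≈⟨ +-cong xy≈xz (sym (-‿distribʳ-* x z)) ⟩
      x * z + - (x * z)  ≈⟨ -‿inverseʳ (x * z) ⟩
      0#                 ∎)
    ... | inj₁ x≈0 = ⊥-elim (x≉0 x≈0)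
    ... | inj₂ y-z≈0 = x∙y⁻¹≈ε⇒x≈y y z y-z≈0

    *≉0 : ∀ {x y} → ¬ x ≈ 0# → ¬ y ≈ 0# → ¬ x * y ≈ 0#
    *≉0 {x} {y} x≉0 y≉0 xy≈0 = [ x≉0 , y≉0 ]′ (integral x y xy≈0)

    ^≉0 : ∀ {x} → ¬ x ≈ 0# → ∀ n → ¬ x ^ n ≈ 0#
    ^≉0 x≉0 zero = 1≉0
    ^≉0 x≉0 (suc n) = *≉0 x≉0 (^≉0 x≉0 n)

    ∣ᴿ-cancel : ∀ {x y z} → ¬ x ≈ 0# → x * y ∣ᴿ x * z → y ∣ᴿ z
    ∣ᴿ-cancel x≉0 (q , eq) = q , *-cancelˡ x≉0 (trans eq (*-assoc _ _ _))

    module Valuation (p : Carrier) (p-prime : PrimeElem R p) where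

      p≉0 : ¬ p ≈ 0#
      p≉0 = proj₁ p-prime

      Val : Carrier → ℕ → Set _
      Val = IsValuation R p

      Val-resp : ∀ {x y e} → x ≈ y → Val x e → Val y e
      Val-resp x≈y (d , nd) = ∣ᴿ-respʳ x≈y d , λ d′ → nd (∣ᴿ-respʳ (sym x≈y) d′)

      Val⇒≤ : ∀ {x e f} → p ^ e ∣ᴿ x → Val x f → e ℕ.≤ f
      Val⇒≤ {e = e} {f} d (_ , nd) with ℕ.≤-<-connex e f
      ... | inj₁ e≤f = e≤f
      ... | inj₂ f<e = ⊥-elim (nd (∣ᴿ-trans (^-∣ᴿ p f<e) d))

      Val-unique : ∀ {x e f} → Val x e → Val x f → e ≡ f
      Val-unique {e = e} {f} ve vf = ℕ.≤-antisym (Val⇒≤ {e = e} {f} (proj₁ ve) vf) (Val⇒≤ {e = f} {e} (proj₁ vf) ve)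

      Val-cofactor : ∀ {x e q} → Val x e → x ≈ p ^ e * q → ¬ p ∣ᴿ q
      Val-cofactor {x} {e} {q} (_ , nd) x≈ (r , q≈pr) = nd (r , (begin
        x                ≈⟨ x≈ ⟩
        p ^ e * q        ≈⟨ *-congˡ q≈pr ⟩
        p ^ e * (p * r)  ≈⟨ *-assoc (p ^ e) p r ⟨
        (p ^ e * p) * r  ≈⟨ *-congʳ (*-comm (p ^ e) p) ⟩
        (p * p ^ e) * r  ∎))

      -- Removing the exact powers leaves two cofactors not divisible by p, and primality keeps p
      -- from dividing their product.
      Val-* : ∀ {x y e f} → Val x e → Val y f → Val (x * y) (e ℕ.+ f)
      Val-* {x} {y} {e} {f} vx@((q , x≈) , _) vy@((r , y≈) , _) = (q * r , xy≈) , λ (s , eq) →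
        [ Val-cofactor {e = e} vx x≈ , Val-cofactor {e = f} vy y≈ ]′ (proj₂ (proj₂ p-prime) q r
          (∣ᴿ-cancel (^≉0 p≉0 (e ℕ.+ f)) (s , (begin
            p ^ (e ℕ.+ f) * (q * r)    ≈⟨ xy≈ ⟨
            x * y                      ≈⟨ eq ⟩
            (p * p ^ (e ℕ.+ f)) * s    ≈⟨ *-congʳ (*-comm p _) ⟩
            (p ^ (e ℕ.+ f) * p) * s    ∎))))
        where
        xy≈ : x * y ≈ p ^ (e ℕ.+ f) * (q * r)
        xy≈ = begin
          x * y                      ≈⟨ *-cong x≈ y≈ ⟩
          (p ^ e * q) * (p ^ f * r)  ≈⟨ interchange (p ^ e) q (p ^ f) r ⟩
          (p ^ e * p ^ f) * (q * r)  ≈⟨ *-congʳ (^-+ p e f) ⟨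
          p ^ (e ℕ.+ f) * (q * r)    ∎

      prime-power-∣ᴿ : ∀ {x y} → ¬ p ∣ᴿ x → ∀ e → p ^ e ∣ᴿ x * y → p ^ e ∣ᴿ y
      prime-power-∣ᴿ p∤x zero _ = _ , sym (*-identityˡ _)
      prime-power-∣ᴿ {x} {y} p∤x (suc e) d@(q , xy≈) with proj₂ (proj₂ p-prime) x y (∣ᴿ-trans (p ^ e , refl) d)
      ... | inj₁ p∣ᴿx = ⊥-elim (p∤x p∣ᴿx)
      ... | inj₂ (y′ , y≈py′) with prime-power-∣ᴿ {x} {y′} p∤x e
              (∣ᴿ-cancel p≉0 (∣ᴿ-respʳ (trans (*-congˡ y≈py′) (x∙yz≈y∙xz x p y′)) d))
      ...   | r , y′≈ = r , trans y≈py′ (trans (*-congˡ y′≈) (sym (*-assoc p (p ^ e) r)))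

      -- Each irreducible factor absorbs at most one factor p.
      power-bound : ∀ xs → All (IrreducibleElem R) xs → ∀ e → length xs ℕ.< e → ¬ p ^ e ∣ᴿ prodR R xs
      power-bound [] [] (suc e) _ (q , 1≈) =
        proj₁ (proj₂ p-prime) (p ^ e * q , sym (trans 1≈ (*-assoc p (p ^ e) q)))
      power-bound (x ∷ xs) ((_ , _ , irr) ∷ irrs) (suc e) (s≤s len<e) d =
        -- The goal is a contradiction, so the case that p does not divide x is refuted instead of
        -- being decided: there the whole power would divide the product of the other factors.
        p∤x-absurd λ (u , x≈pu) → absorbed u x≈pu (irr p u x≈pu)
        where
        w : Carrier
        w = prodR R xs

        p∤x-absurd : ¬ ¬ p ∣ᴿ x
        p∤x-absurd p∤x = power-bound xs irrs (suc e) (ℕ.m≤n⇒m≤1+n len<e) (prime-power-∣ᴿ p∤x (suc e) d)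

        absorbed : ∀ u → x ≈ p * u → IsUnit R p ⊎ IsUnit R u → ⊥
        absorbed u x≈pu (inj₁ p-unit) = proj₁ (proj₂ p-prime) p-unit
        -- Here x is p times a unit: one factor p cancels, and multiplying by the inverse removes
        -- the unit.
        absorbed u x≈pu (inj₂ (u⁻¹ , uu⁻¹≈1)) = power-bound xs irrs e len<e
          (∣ᴿ-respʳ (begin
            (u * w) * u⁻¹    ≈⟨ *-congʳ (*-comm u w) ⟩
            (w * u) * u⁻¹    ≈⟨ *-assoc w u u⁻¹ ⟩
            w * (u * u⁻¹)    ≈⟨ *-congˡ uu⁻¹≈1 ⟩
            w * 1#           ≈⟨ *-identityʳ w ⟩
            w                ∎)
          (∣ᴿ-* u⁻¹ (∣ᴿ-cancel p≉0 (∣ᴿ-respʳ (trans (*-congʳ x≈pu) (*-assoc p u w)) d))))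

      -- Without a valuation every power of p would divide x, up to double negation, against
      -- `power-bound`. Units have no listed factorisation and are excluded first, as p would be a
      -- unit too.
      Val-exists : (∀ x → ¬ x ≈ 0# → ¬ IsUnit R x → ∃[ xs ] (All (IrreducibleElem R) xs × x ≈ prodR R xs)) →
                   ∀ {x} → ¬ x ≈ 0# → ¬ ¬ ∃ (Val x)
      Val-exists factor {x} x≉0 none = nonUnit unit-absurd
        where
        allPowers : ∀ e → ¬ ¬ p ^ e ∣ᴿ x
        allPowers zero k = k (x , sym (*-identityˡ x))
        allPowers (suc e) k = allPowers e λ d → none (e , d , k)

        unit-absurd : ¬ IsUnit R x
        unit-absurd (x⁻¹ , xx⁻¹≈1) = allPowers 1 λ (q , x≈) → proj₁ (proj₂ p-prime) (q * x⁻¹ , (begin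
          p * (q * x⁻¹)         ≈⟨ *-assoc p q x⁻¹ ⟨
          (p * q) * x⁻¹         ≈⟨ *-congʳ (*-congʳ (*-identityʳ p)) ⟨
          ((p * 1#) * q) * x⁻¹  ≈⟨ *-congʳ x≈ ⟨
          x * x⁻¹               ≈⟨ xx⁻¹≈1 ⟩
          1#                    ∎))

        nonUnit : ¬ ¬ IsUnit R x
        nonUnit x-nonUnit with factor x x≉0 x-nonUnit
        ... | xs , irrs , x≈ = allPowers (suc (length xs)) λ d →
          power-bound xs irrs (suc (length xs)) ℕ.≤-refl (∣ᴿ-respʳ x≈ d)

  -- Dirichlet products of fractions as convolutions in the ring.

  module Unfolding (g h : ℕ → Frac R) where

    term : ℕ → ℕ → Frac R
    term i j = if ⌊ suc j ∣? i ⌋ then _*F_ R (g (suc j)) (h (i ℕ./ suc j)) else 0F R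

    -- The recursion inside dirMul is local to its where-block and has no name. Unification recovers it:
    -- first at the arguments (suc k , k), then with the first argument generalised by the with-abstraction.
    mutual
      tail : ℕ → Frac R
      tail = _

      dirMul-suc : ∀ k → dirMul R g h (suc k) ≡ _+F_ R (term (suc k) k) (tail k)
      dirMul-suc k = ≡.refl

    mutual
      partial : ℕ → ℕ → Frac R
      partial = _

      tail≡partial : ∀ k → tail k ≡ partial (suc k) k
      tail≡partial k with suc k
      ... | i = ≡.refl

  -- The index i stays fixed while the counter runs down, so that the sum matches `partial` term by
  -- term.
  convolution : (ℕ → Carrier) → (ℕ → Carrier) → ℕ → ℕ → Carrier
  convolution G H i zero = 0#
  convolution G H i (suc j) = (if ⌊ suc j ∣? i ⌋ then G (suc j) * H (i ℕ./ suc j) else 0#) + convolution G H i j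

  module _ {g h : ℕ → Frac R} {G H : ℕ → Carrier} {D E : Carrier}
    (g≈ : ∀ j → proj₁ (g j) * D ≈ G j * proj₂ (g j)) (h≈ : ∀ j → proj₁ (h j) * E ≈ H j * proj₂ (h j)) where

    open Unfolding g h

    clear-term : ∀ b j k → let t = if b then _*F_ R (g j) (h k) else 0F R in
      proj₁ t * (D * E) ≈ (if b then G j * H k else 0#) * proj₂ t
    clear-term true j k = begin
      (proj₁ (g j) * proj₁ (h k)) * (D * E)      ≈⟨ interchange _ _ D E ⟩
      (proj₁ (g j) * D) * (proj₁ (h k) * E)      ≈⟨ *-cong (g≈ j) (h≈ k) ⟩
      (G j * proj₂ (g j)) * (H k * proj₂ (h k))  ≈⟨ interchange (G j) _ (H k) _ ⟩
      (G j * H k) * (proj₂ (g j) * proj₂ (h k))  ∎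
    clear-term false j k = trans (zeroˡ _) (sym (zeroˡ _))

    -- Fractions are never reduced, so the equality is carried through the recursion in
    -- cross-multiplied form.
    clear : ∀ i j → proj₁ (partial i j) * (D * E) ≈ convolution G H i j * proj₂ (partial i j)
    clear i zero = trans (zeroˡ _) (sym (zeroˡ _))
    clear i (suc j) = add (clear-term ⌊ suc j ∣? i ⌋ (suc j) (i ℕ./ suc j)) (clear i j)
      where
      add : ∀ {t e s f x y z} → t * z ≈ x * e → s * z ≈ y * f → (t * f + s * e) * z ≈ (x + y) * (e * f)
      add {t} {e} {s} {f} {x} {y} {z} t≈ s≈ = begin
        (t * f + s * e) * z           ≈⟨ distribʳ z (t * f) (s * e) ⟩
        (t * f) * z + (s * e) * z     ≈⟨ +-cong (xy∙z≈xz∙y t f z) (xy∙z≈xz∙y s e z) ⟩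
        (t * z) * f + (s * z) * e     ≈⟨ +-cong (*-congʳ t≈) (*-congʳ s≈) ⟩
        (x * e) * f + (y * f) * e     ≈⟨ +-cong (*-assoc x e f) (trans (xy∙z≈xz∙y y f e) (*-assoc y e f)) ⟩
        x * (e * f) + y * (e * f)     ≈⟨ distribʳ (e * f) x y ⟨
        (x + y) * (e * f)             ∎

  module _ {G H : ℕ → Carrier} {q : Carrier} {i : ℕ} where

    private
      Term : ℕ → Carrier
      Term j = G (suc j) * H (i ℕ./ suc j)

    if-∣ᴿ : ∀ {A : Set} {x} (d : Dec A) → (A → q ∣ᴿ x) → q ∣ᴿ (if ⌊ d ⌋ then x else 0#)
    if-∣ᴿ (yes a) q∣ᴿx = q∣ᴿx a
    if-∣ᴿ (no _) _ = ∣ᴿ-zero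

    if-≈ : ∀ {A : Set} {x} (d : Dec A) → A → (if ⌊ d ⌋ then x else 0#) ≈ x
    if-≈ (yes _) _ = refl
    if-≈ (no ¬a) a = ⊥-elim (¬a a)

    convolution-∣ᴿ : ∀ n → (∀ j → j ℕ.< n → suc j ∣ i → q ∣ᴿ Term j) → q ∣ᴿ convolution G H i n
    convolution-∣ᴿ zero _ = ∣ᴿ-zero
    convolution-∣ᴿ (suc n) q∣ᴿ =
      ∣ᴿ-+ (if-∣ᴿ (suc n ∣? i) (q∣ᴿ n ℕ.≤-refl)) (convolution-∣ᴿ n λ j j<n → q∣ᴿ j (ℕ.m≤n⇒m≤1+n j<n))

    -- With q a power of p just beyond the valuation of one term, this isolates that term from a
    -- negligible rest.
    convolution-split : ∀ n j → j ℕ.< n → suc j ∣ i → (∀ j′ → ¬ j′ ≡ j → suc j′ ∣ i → q ∣ᴿ Term j′) →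
      ∃ λ r → convolution G H i n ≈ Term j + r × q ∣ᴿ r
    convolution-split (suc n) j j≤n j∣i q∣ᴿ with ℕ.m<1+n⇒m<n∨m≡n j≤n
    ... | inj₂ ≡.refl = convolution G H i n , +-congʳ (if-≈ (suc n ∣? i) j∣i) ,
      convolution-∣ᴿ n λ j′ j′<n → q∣ᴿ j′ (ℕ.<⇒≢ j′<n)
    ... | inj₁ j<n with convolution-split n j j<n j∣i q∣ᴿ
    ...   | r , eq , q∣ᴿr = t + r , (begin
        t + convolution G H i n  ≈⟨ +-congˡ eq ⟩
        t + (Term j + r)         ≈⟨ +-assoc t (Term j) r ⟨
        (t + Term j) + r         ≈⟨ +-congʳ (+-comm t (Term j)) ⟩
        (Term j + t) + r         ≈⟨ +-assoc (Term j) t r ⟩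
        Term j + (t + r)         ∎) ,
      ∣ᴿ-+ (if-∣ᴿ (suc n ∣? i) (q∣ᴿ n λ n≡j → ℕ.<⇒≢ j<n (≡.sym n≡j))) q∣ᴿr
      where
      t : Carrier
      t = if ⌊ suc n ∣? i ⌋ then Term n else 0#

  -- The product of the first N denominators without the one at j; from N on nothing is left out,
  -- and the coefficients vanish there.
  cofactor : (ℕ → Carrier) → ℕ → ℕ → Carrier
  denominator : (ℕ → Carrier) → ℕ → Carrier
  denominator d zero = 1#
  denominator d (suc N) = d N * denominator d N
  cofactor d zero j = 1#
  cofactor d (suc N) j with j ℕ.≟ N
  ... | yes _ = denominator d N
  ... | no _ = d N * cofactor d N j

  cofactor-* : ∀ d N j → j ℕ.< N → d j * cofactor d N j ≈ denominator d N
  cofactor-* d (suc N) j j≤N with j ℕ.≟ N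
  ... | yes ≡.refl = refl
  ... | no j≢N = trans (x∙yz≈y∙xz (d j) (d N) _)
    (*-congˡ (cofactor-* d N j (ℕ.≤∧≢⇒< (ℕ.≤-pred j≤N) j≢N)))

  -- The entry at 0 is no coefficient of the Dirichlet polynomial and may be arbitrary.
  Supp : (ℕ → Carrier) → ℕ → Set ℓ
  Supp G j = 1 ℕ.≤ j × ¬ G j ≈ 0#

  -- The ultrametric law for the coefficients of a product.

  module Coefficients (1≉0 : ¬ 1# ≈ 0#) (integral : ∀ x y → x * y ≈ 0# → x ≈ 0# ⊎ y ≈ 0#)
    (G H a : ℕ → Carrier) (Δ : Carrier) (Δa≈ : ∀ i → 1 ℕ.≤ i → Δ * a i ≈ convolution G H i i)
    (G? : ∀ j → Dec (G j ≈ 0#)) (H? : ∀ j → Dec (H j ≈ 0#))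
    (p : Carrier) (p-prime : PrimeElem R p) (g h ν : ℕ → ℕ) (δ : ℕ) where

    open Domain 1≉0 integral
    open Valuation p p-prime

    module _ (valG : ∀ j → ¬ G j ≈ 0# → Val (G j) (g j)) (valH : ∀ j → ¬ H j ≈ 0# → Val (H j) (h j))
      (valΔ : Val Δ δ) (vala : ∀ i → ¬ a i ≈ 0# → Val (a i) (ν i)) where

      valΔa : ∀ {i} → ¬ a i ≈ 0# → Val (Δ * a i) (δ ℕ.+ ν i)
      valΔa {i} aᵢ≉0 = Val-* {e = δ} {ν i} valΔ (vala i aᵢ≉0)

      product-∣ᴿ : ∀ {e} j k → (¬ G j ≈ 0# → ¬ H k ≈ 0# → e ℕ.≤ g j ℕ.+ h k) → p ^ e ∣ᴿ G j * H k
      product-∣ᴿ j k le with G? j | H? k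
      ... | yes Gj≈0 | _ = ∣ᴿ-respʳ (sym (trans (*-congʳ Gj≈0) (zeroˡ _))) ∣ᴿ-zero
      ... | no _ | yes Hk≈0 = ∣ᴿ-respʳ (sym (trans (*-congˡ Hk≈0) (zeroʳ _))) ∣ᴿ-zero
      ... | no Gj≉0 | no Hk≉0 =
        ∣ᴿ-trans (^-∣ᴿ p (le Gj≉0 Hk≉0)) (proj₁ (Val-* {e = g j} {h k} (valG j Gj≉0) (valH k Hk≉0)))

      quotient-positive : ∀ {i j} → 1 ℕ.≤ i → suc j ∣ i → 1 ℕ.≤ i ℕ./ suc j
      quotient-positive {i} {j} 1≤i j∣i = ℕ.n≢0⇒n>0 λ k≡0 → ℕ.<⇒≢ 1≤i
        (≡.sym (≡.trans (≡.sym (m*[n/m]≡n j∣i)) (≡.trans (≡.cong (suc j ℕ.*_) k≡0) (ℕ.*-zeroʳ j))))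

      -- If every term had valuation beyond that of Δaᵢ, then p to the power δ + νᵢ + 1 would divide
      -- their sum Δaᵢ.
      cover : ∀ i → 1 ℕ.≤ i → ¬ a i ≈ 0# →
        ∃₂ λ j k → Supp G j × Supp H k × j ℕ.* k ≡ i × g j ℕ.+ h k ℕ.≤ ν i ℕ.+ δ
      cover i 1≤i aᵢ≉0
        with ℕ.anyUpTo? (λ j → suc j ∣? i ×-dec (¬? (G? (suc j)) ×-dec (¬? (H? (i ℕ./ suc j)) ×-dec
               (g (suc j) ℕ.+ h (i ℕ./ suc j)) ℕ.≤? (ν i ℕ.+ δ)))) i
      ... | yes (j , _ , j∣i , Gj≉0 , Hk≉0 , le) =
        suc j , i ℕ./ suc j , (s≤s z≤n , Gj≉0) , (quotient-positive 1≤i j∣i , Hk≉0) , m*[n/m]≡n j∣i , le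
      ... | no none = ⊥-elim (proj₂ (valΔa aᵢ≉0) (∣ᴿ-respʳ (sym (Δa≈ i 1≤i))
        (convolution-∣ᴿ i λ j j<i j∣i → product-∣ᴿ {suc (δ ℕ.+ ν i)} (suc j) (i ℕ./ suc j) λ Gj≉0 Hk≉0 →
          ℕ.≰⇒> λ le → none (j , j<i , j∣i , Gj≉0 , Hk≉0 , ℕ.≤-trans le (ℕ.≤-reflexive (ℕ.+-comm δ (ν i)))))))

      -- All other terms are divisible by one more power of p than the chosen one, so the sum
      -- inherits its exact valuation and in particular is nonzero.
      unique : ∀ j k → Supp G j → Supp H k →
        (∀ j′ k′ → Supp G j′ → Supp H k′ → j′ ℕ.* k′ ≡ j ℕ.* k → j′ ≡ j ⊎ g j ℕ.+ h k ℕ.< g j′ ℕ.+ h k′) →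
        (¬ a (j ℕ.* k) ≈ 0#) × ν (j ℕ.* k) ℕ.+ δ ≡ g j ℕ.+ h k
      unique (suc j) k (_ , Gj≉0) (1≤k , Hk≉0) sole
        with convolution-split {G} {H} {p ^ suc (g (suc j) ℕ.+ h k)} {suc j ℕ.* k} (suc j ℕ.* k) j
               (ℕ.≤-trans (ℕ.≤-reflexive (≡.sym (ℕ.*-identityʳ (suc j)))) (ℕ.*-monoʳ-≤ (suc j) 1≤k)) (m∣m*n k)
               (λ j′ j′≢j j′∣i → product-∣ᴿ (suc j′) (suc j ℕ.* k ℕ./ suc j′) λ G≉0 H≉0 →
                 [ (λ eq → ⊥-elim (j′≢j (ℕ.suc-injective eq))) , (λ lt → lt) ]′
                   (sole (suc j′) (suc j ℕ.* k ℕ./ suc j′) (s≤s z≤n , G≉0)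
                     (quotient-positive (ℕ.*-mono-≤ (s≤s (z≤n {j})) 1≤k) j′∣i , H≉0) (m*[n/m]≡n j′∣i)))
      ... | r , eq , q∣ᴿr = aᵢ≉0 , ≡.trans (ℕ.+-comm (ν i) δ) (Val-unique (valΔa aᵢ≉0) val)
        where
        i e : ℕ
        i = suc j ℕ.* k
        e = g (suc j) ℕ.+ h k

        Δa≈GH+r : Δ * a i ≈ G (suc j) * H k + r
        Δa≈GH+r = trans (Δa≈ i (ℕ.*-mono-≤ (s≤s (z≤n {j})) 1≤k)) (trans eq
          (+-congʳ (*-congˡ (reflexive (≡.cong H (≡.trans (≡.cong (ℕ._/ suc j) (ℕ.*-comm (suc j) k)) (m*n/n≡m k (suc j))))))))

        valGH : Val (G (suc j) * H k) e
        valGH = Val-* {e = g (suc j)} {h k} (valG (suc j) Gj≉0) (valH k Hk≉0)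

        val : Val (Δ * a i) e
        val = Val-resp {e = e} (sym Δa≈GH+r)
          (∣ᴿ-+ (proj₁ valGH) (∣ᴿ-trans (^-∣ᴿ p (ℕ.n≤1+n e)) q∣ᴿr) , λ d → proj₂ valGH (∣ᴿ-+-cancel d q∣ᴿr))

        aᵢ≉0 : ¬ a i ≈ 0#
        aᵢ≉0 aᵢ≈0 = proj₂ val (∣ᴿ-respʳ (sym (trans (*-congˡ aᵢ≈0) (zeroʳ Δ))) ∣ᴿ-zero)

  -- Clearing the denominators of a Dirichlet polynomial.

  module FractionField (1≉0 : ¬ 1# ≈ 0#) (integral : ∀ x y → x * y ≈ 0# → x ≈ 0# ⊎ y ≈ 0#) where
    open Domain 1≉0 integral

    denominator≉0 : ∀ d → (∀ j → ¬ d j ≈ 0#) → ∀ N → ¬ denominator d N ≈ 0#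
    denominator≉0 d d≉0 zero = 1≉0
    denominator≉0 d d≉0 (suc N) = *≉0 (d≉0 N) (denominator≉0 d d≉0 N)

    module Cleared (g : ℕ → Frac R) (isPoly : IsDirPolyQ R g) where

      den : ℕ → Carrier
      den j = proj₂ (g j)

      N : ℕ
      -- The degree bound in `IsDirPolyQ` is inclusive, hence the successor.
      N = suc (proj₁ (proj₂ isPoly))

      D : Carrier
      D = denominator den N

      D≉0 : ¬ D ≈ 0#
      D≉0 = denominator≉0 den (proj₁ isPoly) N

      coeff : ℕ → Carrier
      coeff j = proj₁ (g j) * cofactor den N j

      coeff-zero : ∀ j → N ≤ j → coeff j ≈ 0#
      coeff-zero j N≤j = trans (*-congʳ (proj₂ (proj₂ isPoly) j N≤j)) (zeroˡ _)

      coeff-≈ : ∀ j → proj₁ (g j) * D ≈ coeff j * den j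
      coeff-≈ j with ℕ.<-≤-connex j N
      ... | inj₁ j<N = begin
        proj₁ (g j) * D                            ≈⟨ *-congˡ (cofactor-* den N j j<N) ⟨
        proj₁ (g j) * (den j * cofactor den N j)   ≈⟨ *-congˡ (*-comm (den j) _) ⟩
        proj₁ (g j) * (cofactor den N j * den j)   ≈⟨ *-assoc _ _ _ ⟨
        coeff j * den j                            ∎
      ... | inj₂ N≤j = trans (trans (*-congʳ (proj₂ (proj₂ isPoly) j N≤j)) (zeroˡ D))
                             (sym (trans (*-congʳ (coeff-zero j N≤j)) (zeroˡ (den j))))

      coeff≉0 : ∀ {j} → ¬ proj₁ (g j) ≈ 0# → ¬ coeff j ≈ 0#
      coeff≉0 {j} gⱼ≉0 coeffⱼ≈0 = *≉0 gⱼ≉0 D≉0 (trans (coeff-≈ j) (trans (*-congʳ coeffⱼ≈0) (zeroˡ (den j))))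

      Supp-bound : ∀ j → Supp coeff j → j < N
      Supp-bound j (_ , coeffⱼ≉0) with ℕ.<-≤-connex j N
      ... | inj₁ j<N = j<N
      ... | inj₂ N≤j = ⊥-elim (coeffⱼ≉0 (coeff-zero j N≤j))

      module Decided (zero? : ∀ j → Dec (coeff j ≈ 0#)) (nonConstant : NonConstantQ R g) where

        nontrivial : ∃[ j ] (2 ≤ j × Supp coeff j)
        nontrivial = let j , 2≤j , gⱼ≉0 = nonConstant in j , 2≤j , ℕ.<⇒≤ 2≤j , coeff≉0 gⱼ≉0

        supp : Support (Supp coeff)
        supp = support (λ j → (1 ℕ.≤? j) ×-dec ¬? (zero? j)) (λ (1≤j , _) → ℕ.>-nonZero 1≤j) N Supp-bound
          (proj₁ nontrivial , proj₂ (proj₂ nontrivial))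

        module _ (ufd : IsUFD R) (p : Carrier) (p-prime : PrimeElem R p) where
          open Valuation p p-prime

          valuations : ¬ ¬ (∃ λ v → ∀ j → ¬ coeff j ≈ 0# → Val (coeff j) (v j))
          valuations k = ¬¬-pull {P = λ j → ∃ λ e → ¬ coeff j ≈ 0# → Val (coeff j) e} N
            -- Zero coefficients receive the default valuation 0.
            (λ j N≤j → 0 , λ coeffⱼ≉0 → ⊥-elim (coeffⱼ≉0 (coeff-zero j N≤j)))
            (λ j → single j (zero? j))
            λ v → k (proj₁ ∘ v , proj₂ ∘ v)
            where
            single : ∀ j → Dec (coeff j ≈ 0#) → ¬ ¬ (∃ λ e → ¬ coeff j ≈ 0# → Val (coeff j) e)
            single j (yes coeffⱼ≈0) k = k (0 , λ coeffⱼ≉0 → ⊥-elim (coeffⱼ≉0 coeffⱼ≈0))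
            single j (no coeffⱼ≉0) k =
              Val-exists (proj₁ (proj₂ ufd)) coeffⱼ≉0 λ (e , val) → k (e , λ _ → val)

    module _ (g h : ℕ → Frac R) (isPolyG : IsDirPolyQ R g) (isPolyH : IsDirPolyQ R h) where
      private
        module G = Cleared g isPolyG
        module H = Cleared h isPolyH

      open Unfolding g h

      partial-den≉0 : ∀ i j → ¬ proj₂ (partial i j) ≈ 0#
      partial-den≉0 i zero = 1≉0
      partial-den≉0 i (suc j) = *≉0 (term-den≉0 ⌊ suc j ∣? i ⌋ (suc j) (i ℕ./ suc j)) (partial-den≉0 i j)
        where
        term-den≉0 : ∀ b j k → ¬ proj₂ (if b then _*F_ R (g j) (h k) else 0F R) ≈ 0#
        term-den≉0 true j k = *≉0 (proj₁ isPolyG j) (proj₁ isPolyH k)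
        term-den≉0 false j k = 1≉0

      -- Both sides agree after multiplication by the denominator of the unreduced sum, which is
      -- nonzero.
      cleared-product : ∀ {a : ℕ → Carrier} → (∀ i → 1 ≤ i → FracEq R (a i , 1#) (dirMul R g h i)) →
        ∀ i → 1 ≤ i → (G.D * H.D) * a i ≈ convolution G.coeff H.coeff i i
      cleared-product {a} a≈ i 1≤i = *-cancelˡ (partial-den≉0 i i) (begin
        e * (Δ * a i)                            ≈⟨ *-comm e (Δ * a i) ⟩
        (Δ * a i) * e                            ≈⟨ *-assoc Δ (a i) e ⟩
        Δ * (a i * e)                            ≈⟨ *-congˡ (a≈ i 1≤i) ⟩
        Δ * (s * 1#)                             ≈⟨ *-congˡ (*-identityʳ s) ⟩
        Δ * s                                    ≈⟨ *-comm Δ s ⟩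
        s * Δ                                    ≈⟨ clear G.coeff-≈ H.coeff-≈ i i ⟩
        convolution G.coeff H.coeff i i * e      ≈⟨ *-comm _ e ⟩
        e * convolution G.coeff H.coeff i i      ∎)
        where
        Δ = G.D * H.D
        s = proj₁ (partial i i)
        e = proj₂ (partial i i)

-- From a factorisation to a relative degree common to all primes.

module _ (R : CommutativeRing c ℓ) (ufd : IsUFD R) where
  open CommutativeRing R hiding (zero)
  open RingTheory R
  open Domain (proj₁ (proj₁ ufd)) (proj₂ (proj₁ ufd))
  open FractionField (proj₁ (proj₁ ufd)) (proj₂ (proj₁ ufd))

  module _ (a : ℕ → Carrier) (m n : ℕ) (1≤m : 1 ≤ m)
    (aₘ≉0 : ¬ a m ≈ 0#) (aₙ≉0 : ¬ a n ≈ 0#) (outside : ∀ i → i < m ⊎ n < i → a i ≈ 0#)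
    (coprime : ∀ d → (∀ i → ¬ a i ≈ 0# → d ∣ i) → d ≡ 1)
    (k : ℕ) (p : Fin (suc k) → Carrier) (p-prime : ∀ t → PrimeElem R (p t))
    (ν : Fin (suc k) → ℕ → ℕ) (val : ∀ t i → ¬ a i ≈ 0# → IsValuation R (p t) (a i) (ν t i))
    (g h : ℕ → Frac R) (polyG : IsDirPolyQ R g) (polyH : IsDirPolyQ R h)
    (nonConstG : NonConstantQ R g) (nonConstH : NonConstantQ R h)
    (a≈gh : ∀ i → 1 ≤ i → FracEq R (a i , 1#) (dirMul R g h i)) where

    private
      module G = Cleared g polyG
      module H = Cleared h polyH

      S : ℕ → Set ℓ
      S i = ¬ a i ≈ 0#

      m≤ : ∀ i → S i → m ≤ i
      m≤ i aᵢ≉0 = ℕ.≮⇒≥ λ i<m → aᵢ≉0 (outside i (inj₁ i<m))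

      ≤n : ∀ i → S i → i ≤ n
      ≤n i aᵢ≉0 = ℕ.≮⇒≥ λ n<i → aᵢ≉0 (outside i (inj₂ n<i))

      FactorsAt : Fin (suc k) → Set ℓ
      FactorsAt t = ∃ λ vg → ∃ λ vh → ∃ λ δ → Factorisation (Supp G.coeff) (Supp H.coeff) S vg vh (ν t) δ

    module _ (G? : ∀ j → Dec (G.coeff j ≈ 0#)) (H? : ∀ j → Dec (H.coeff j ≈ 0#)) where

      private
        module DG = G.Decided G? nonConstG
        module DH = H.Decided H? nonConstH
        module SG = Support DG.supp
        module SH = Support DH.supp

      -- The shift is the valuation of the product of the two common denominators.
      factorisation : ∀ t → ¬ ¬ FactorsAt t
      factorisation t k =
        DG.valuations ufd (p t) (p-prime t) λ (vg , valG) →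
        DH.valuations ufd (p t) (p-prime t) λ (vh , valH) →
        Val-exists (proj₁ (proj₂ ufd)) (*≉0 G.D≉0 H.D≉0) λ (δ , valΔ) →
        k (vg , vh , δ , record
          { cover = λ i aᵢ≉0 → cover vg vh δ valG valH valΔ (val t) i (ℕ.≤-trans 1≤m (m≤ i aᵢ≉0)) aᵢ≉0
          ; unique = unique vg vh δ valG valH valΔ (val t) })
        where
        open Valuation (p t) (p-prime t)
        module C (vg vh : ℕ → ℕ) (δ : ℕ) = Coefficients (proj₁ (proj₁ ufd)) (proj₂ (proj₁ ufd)) G.coeff H.coeff a
          (G.D * H.D) (cleared-product g h polyG polyH a≈gh) G? H? (p t) (p-prime t) vg vh (ν t) δ
        open C

      polygon-decidable : ∀ t → ¬ ¬ (∀ x → Dec (LogIntegralAt S (ν t) x))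
      polygon-decidable t = ¬¬-pull (suc n) (λ x n<x → no λ on → ℕ.<⇒≱ n<x (LogIntegral⇒≤ {v = ν t} ≤n on)) λ _ → ¬¬-dec

      inProductsG : ∀ t → ¬ ¬ InProducts S (ν t) SG.last SG.first
      inProductsG t k = factorisation t λ (_ , _ , _ , F) → polygon-decidable t λ L? →
        k (factor-inProducts DG.supp DH.supp F L?)

      inProductsH : ∀ t → ¬ ¬ InProducts S (ν t) SH.last SH.first
      inProductsH t k = factorisation t λ (_ , _ , _ , F) → polygon-decidable t λ L? →
        k (factor-inProducts DH.supp DG.supp (swap SH.nonZero F) L?)

      common-degree : ¬ ¬ (∃[ d ] ∃[ c′ ] (InS1rd m n d c′ × (∀ t → InProducts S (ν t) d c′)))
      -- The ratios last/first do not depend on the prime, so they are compared once, and the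
      -- factorisation at the first prime supplies the bounds.
      common-degree k = factorisation zero λ (_ , _ , _ , F) →
        [ (λ le → ¬¬-pull-Fin inProductsG λ inG → k (SG.last , SG.first ,
            inS1rd DG.supp DH.supp F aₘ≉0 aₙ≉0 m≤ ≤n
              (first<last DG.supp DH.supp F aₘ≉0 aₙ≉0 m≤ ≤n coprime DG.nontrivial) le , inG))
        , (λ le → ¬¬-pull-Fin inProductsH λ inH → k (SH.last , SH.first ,
            inS1rd DH.supp DG.supp (swap SH.nonZero F) aₘ≉0 aₙ≉0 m≤ ≤n
              (first<last DH.supp DG.supp (swap SH.nonZero F) aₘ≉0 aₙ≉0 m≤ ≤n coprime DH.nontrivial) le , inH))
        ]′ (ℕ.≤-total (SG.last ℕ.* SH.first) (SH.last ℕ.* SG.first))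

    reducible⇒common-degree : ¬ ¬ (∃[ d ] ∃[ c′ ] (InS1rd m n d c′ × (∀ t → InProducts S (ν t) d c′)))
    reducible⇒common-degree k =
      ¬¬-pull G.N (λ j N≤j → yes (G.coeff-zero j N≤j)) (λ _ → ¬¬-dec) λ G? →
      ¬¬-pull H.N (λ j N≤j → yes (H.coeff-zero j N≤j)) (λ _ → ¬¬-dec) λ H? →
      common-degree G? H? k

theorem5p1 : ∀ {c ℓ} (R : CommutativeRing c ℓ) → IsUFD R →
    (a : ℕ → CommutativeRing.Carrier R) (m n : ℕ) → 1 ≤ m → m ≤ n →
    ¬ CommutativeRing._≈_ R (a m) (CommutativeRing.0# R) →
    ¬ CommutativeRing._≈_ R (a n) (CommutativeRing.0# R) →
    (∀ i → i < m ⊎ n < i → CommutativeRing._≈_ R (a i) (CommutativeRing.0# R)) →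
    (∀ d → (∀ i → ¬ CommutativeRing._≈_ R (a i) (CommutativeRing.0# R) → d ∣ i) → d ≡ 1) →
    (k : ℕ) → 1 ≤ k → (p : Fin k → CommutativeRing.Carrier R) →
    (∀ t → PrimeElem R (p t)) →
    (ν : Fin k → ℕ → ℕ) →
    (∀ t i → ¬ CommutativeRing._≈_ R (a i) (CommutativeRing.0# R) →
    IsValuation R (p t) (a i) (ν t i)) →
    ¬ (∃[ d ] ∃[ c' ] (InS1rd m n d c' ×
    (∀ t → InProducts (λ i → ¬ CommutativeRing._≈_ R (a i) (CommutativeRing.0# R)) (ν t) d c'))) →
    IrreducibleOverQ R a
theorem5p1 R ufd a m n 1≤m _ aₘ≉0 aₙ≉0 outside coprime (suc k) _ p p-prime ν val noCommon
  (g , h , polyG , polyH , nonConstG , nonConstH , a≈gh) =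
  reducible⇒common-degree R ufd a m n 1≤m aₘ≉0 aₙ≉0 outside coprime k p p-prime ν val
    g h polyG polyH nonConstG nonConstH a≈gh noCommon
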